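{- For each integer $n\ge 3$ let $G_n$ be the cubic graph, $C_0$ and $C_1$ the Hamiltonian cycles of $G_n$, and $g=\Lambda u_1$ the distinguished (green) edge, all defined in the context. Then, for every $n\ge 3$, Thomason's algorithm in $G_n$ started with the cycle $C_0$ and the edge $g$ (with initial vertex $\Lambda$) terminates with the cycle $C_1$. Moreover, the number of steps (lollipops) it takes is $\Theta(c^n)$ as $n\to\infty$, where $c>1$ is a constant with $c\approx 1.3953\ldots$ (the decimal expansion of $c$ begins $1.3953$).
   Context: **Lollipops and Thomason's algorithm.** Let $G$ be a cubic graph with $N$ vertices. Define an auxiliary graph $K(G)$ whose vertices are the oriented Hamiltonian paths of $G$. If $P=(p_1,\dots,p_N)$ is such a path and $p_i$, with $1<i<N-1$, is a neighbour of $p_N$ in $G$, then $P$ is adjacent in $K(G)$ to $Q=(p_1,\dots,p_i,p_N,p_{N-1},\dots,p_{i+1})$. This relation is symmetric. Every vertex of $K(G)$ has degree 1 or 2, and it has degree 1 exactly when $p_N$ is adjacent to $p_1$, i.e. when $P$ together with the edge $p_Np_1$ is a Hamiltonian cycle. Moving from a path to an adjacent one in $K(G)$ is called a lollipop (one step). Given a Hamiltonian cycle $C$, an edge $e=p_1p_2$ of $C$ and the initial vertex $p_1$, Thomason's algorithm starts from the oriented Hamiltonian path that begins $p_1,p_2$ and follows $C$. It repeatedly performs lollipops without ever moving back to the previous path, until it reaches another vertex of degree 1 of $K(G)$. It outputs the corresponding Hamiltonian cycle, which also contains $e$. **The graph $G_n$.** It consists of a triangle (the cap) on vertices $\Lambda,x,y$,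 then $n$ gadgets, the $i$-th having vertices $u_i,v_i$ ($1\le i\le n$), and a final triangle (the pac) on vertices $a,b,c'$. Use the notational convention $v_{ -1}=\Lambda$, $v_0=y$, $u_0=x$, $v_{n+1}=a$, $u_{n+1}=c'$, $u_{n+2}=b$. The edges of $G_n$ are the three edges of each of the two triangles $\Lambda xy$ and $abc'$, together with - $u_iv_i$ for $1\le i\le n$ (the edge inside the $i$-th gadget), - $u_iv_{i+1}$ for $0\le i\le n$, - $v_iu_{i+2}$ for $-1\le i\le n$. Thus $|V(G_n)|=2n+6$ and $|E(G_n)|=3n+9$. The green edge is $g=\Lambda u_1$. **The cycles.** $C_0$ is the Hamiltonian cycle with edges $u_iv_i$ ($1\le i\le n$), $v_iu_{i+2}$ ($-1\le i\le n$), $\Lambda x$, $xy$, $ab$, $ac'$. $C_1$ is the Hamiltonian cycle with edges $u_iv_i$ for even $i$ with $1\le i\le n$; $u_iv_{i+1}$ for all $0\le i\le n$; $v_iu_{i+2}$ for all odd $i$ with $-1\le i\le n$; $\Lambda y$, $xy$; and, in the pac, $ab,bc'$ if $n$ is even and $ac',bc'$ if $n$ is odd. -}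

module Defs where

open import Data.Fin using (Fin; zero; suc; toℕ; fromℕ; inject₁)
open import Data.Fin.Properties using (fromℕ≢inject₁)
import Data.Integer as ℤ
open import Data.List using (List; []; _∷_; _++_; _∷ʳ_; reverse)
open import Data.List.Membership.Propositional using (_∈_)
open import Data.List.Relation.Unary.Linked using (Linked)
open import Data.List.Relation.Unary.Unique.Propositional using (Unique)
open import Data.Nat using (ℕ; zero; suc; _+_; _≤_; _⊔_; parity)
import Data.Nat.Properties as ℕ
open import Data.Parity.Base using (0ℙ; 1ℙ)
open import Data.Product using (_×_; _,_; ∃-syntax; ∃!)
open import Data.Rational as ℚ using (ℚ; 0ℚ; 1ℚ)
import Data.Rational.Properties as ℚ
open import Data.Rational.Solver using (module +-*-Solver)
open import Function.Bundles using (_⇔_)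
open import Level using (0ℓ)
open import Relation.Binary.Core using (Rel)
open import Relation.Binary.Construct.Closure.Symmetric as Sym using (SymClosure; fwd; bwd)
open import Relation.Binary.Definitions using (Symmetric; Irreflexive)
open import Relation.Binary.PropositionalEquality
  using (_≡_; _≢_; refl; sym; trans; cong; subst)
open import Relation.Nullary using (¬_)

record Graph : Set₁ where
  infix 4 _~_
  field
    Vertex  : Set
    _~_     : Rel Vertex 0ℓ
    ~-sym   : Symmetric _~_
    ~-irref : Irreflexive _≡_ _~_

module Lollipops (G : Graph) where
  open Graph G

  -- An oriented Hamiltonian path (p₁,…,p_N); N is the length of the list.
  record HamPath : Set where
    field
      verts    : List Vertex
      linked   : Linked _~_ verts
      unique   : Unique verts
      spanning : ∀ s → s ∈ verts

  open HamPath public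

  infix 4 _≈_
  _≈_ : Rel HamPath 0ℓ
  P ≈ Q = verts P ≡ verts Q

  -- Adjacency in K(G).  Here init = (p₁,…,p_{i-1}) and
  -- mid = (p_{i+1},…,p_{N-1}); they are non-empty because 1 < i < N-1.
  record Lollipop (P Q : HamPath) : Set where
    field
      init mid : List Vertex
      pᵢ p_N   : Vertex
      init≢[]  : init ≢ []
      mid≢[]   : mid ≢ []
      chord    : pᵢ ~ p_N
      before   : verts P ≡ init ++ pᵢ ∷ (mid ∷ʳ p_N)
      after    : verts Q ≡ init ++ pᵢ ∷ p_N ∷ reverse mid

  DegreeOne : HamPath → Set
  DegreeOne P = ∃! _≈_ (Lollipop P)

  -- Continue P Q k S: when the path Q has just been reached from P, the
  -- algorithm performs exactly k more lollipops and stops at S.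
  data Continue : HamPath → HamPath → ℕ → HamPath → Set where
    stop : ∀ {P Q} → DegreeOne Q → Continue P Q 0 Q
    step : ∀ {P Q R S k} → ¬ DegreeOne Q → Lollipop Q R → ¬ (R ≈ P) →
           Continue Q R k S → Continue P Q (suc k) S

  data Run : HamPath → ℕ → HamPath → Set where
    start : ∀ {P Q S k} → DegreeOne P → Lollipop P Q →
            Continue P Q k S → ¬ (S ≈ P) → Run P (suc k) S

  EdgeSet : Set₁
  EdgeSet = Rel Vertex 0ℓ

  closeUp : List Vertex → List Vertex
  closeUp []       = []
  closeUp (p ∷ ps) = (p ∷ ps) ∷ʳ p

  Consecutive : List Vertex → Rel Vertex 0ℓ
  Consecutive ps s t = ∃[ xs ] ∃[ ys ] ps ≡ xs ++ s ∷ t ∷ ys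

  -- P together with the edge p_N p₁ is a Hamiltonian cycle of G, and C is
  -- its set of (undirected) edges.
  record _Follows_ (P : HamPath) (C : EdgeSet) : Set where
    field
      closed : Linked _~_ (closeUp (verts P))
      edges  : ∀ s t → C s t ⇔ SymClosure (Consecutive (closeUp (verts P))) s t

  StartsWith : HamPath → Vertex → Vertex → Set
  StartsWith P p₁ p₂ = ∃[ ps ] verts P ≡ p₁ ∷ p₂ ∷ ps

  -- Started from the cycle C, the edge p₁p₂ and the initial vertex p₁, the
  -- algorithm terminates with the cycle D after exactly k lollipops.
  Thomason : (C : EdgeSet) (p₁ p₂ : Vertex) (D : EdgeSet) (k : ℕ) → Set
  Thomason C p₁ p₂ D k =
    ∃[ P ] ∃[ S ] StartsWith P p₁ p₂ × P Follows C × Run P k S × S Follows D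

-- u i is u_{toℕ i} (0 ≤ toℕ i ≤ n+2), but v i is v_{toℕ i - 1}, since the
-- subscripts of the v's range from -1 to n+1.
data Vertex (n : ℕ) : Set where
  u v : Fin (3 + n) → Vertex n

module _ {n : ℕ} where

  Λ x y a b c′ : Vertex n
  Λ  = v zero
  x  = u zero
  y  = v (suc zero)
  a  = v (fromℕ (2 + n))
  c′ = u (inject₁ (fromℕ (1 + n)))
  b  = u (fromℕ (2 + n))

  u₁ : Vertex n
  u₁ = u (suc zero)

  -- The edges u_k v_k with k = toℕ i + 1.
  inside-u inside-v : Fin n → Vertex n
  inside-u i = u (suc (inject₁ (inject₁ i)))
  inside-v i = v (suc (suc (inject₁ i)))

  -- The edges u_k v_{k+1} with k = toℕ i.
  uv-u uv-v : Fin (1 + n) → Vertex n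
  uv-u i = u (inject₁ (inject₁ i))
  uv-v i = v (suc (suc i))

  -- The edges v_k u_{k+2} with k = toℕ i - 1; so k is odd iff toℕ i is even.
  vu-v vu-u : Fin (2 + n) → Vertex n
  vu-v i = v (inject₁ i)
  vu-u i = u (suc i)

  data Edge : Rel (Vertex n) 0ℓ where
    Λx     : Edge Λ x
    Λy     : Edge Λ y
    xy     : Edge x y
    ab     : Edge a b
    ac′    : Edge a c′
    bc′    : Edge b c′
    inside : ∀ i → Edge (inside-u i) (inside-v i)
    uv     : ∀ i → Edge (uv-u i) (uv-v i)
    vu     : ∀ i → Edge (vu-v i) (vu-u i)

  data Edge₀ : Rel (Vertex n) 0ℓ where
    inside : ∀ i → Edge₀ (inside-u i) (inside-v i)
    vu     : ∀ i → Edge₀ (vu-v i) (vu-u i)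
    Λx     : Edge₀ Λ x
    xy     : Edge₀ x y
    ab     : Edge₀ a b
    ac′    : Edge₀ a c′

  data Edge₁ : Rel (Vertex n) 0ℓ where
    inside : ∀ i → parity (suc (toℕ i)) ≡ 0ℙ → Edge₁ (inside-u i) (inside-v i)
    uv     : ∀ i → Edge₁ (uv-u i) (uv-v i)
    vu     : ∀ i → parity (toℕ i) ≡ 0ℙ → Edge₁ (vu-v i) (vu-u i)
    Λy     : Edge₁ Λ y
    xy     : Edge₁ x y
    ab     : parity n ≡ 0ℙ → Edge₁ a b
    ac′    : parity n ≡ 1ℙ → Edge₁ a c′
    bc′    : Edge₁ b c′

u-injective : ∀ {n} {i j : Fin (3 + n)} → u i ≡ u j → i ≡ j
u-injective refl = refl

Edge-irrefl : ∀ {n} {s t : Vertex n} → s ≡ t → ¬ Edge s t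
Edge-irrefl p bc′ = fromℕ≢inject₁ (u-injective p)

G : ℕ → Graph
G n = record
  { Vertex  = Vertex n
  ; _~_     = SymClosure Edge
  ; ~-sym   = Sym.symmetric Edge
  ; ~-irref = λ { p (fwd e) → Edge-irrefl p e ; p (bwd e) → Edge-irrefl (sym p) e }
  }

C₀ C₁ : (n : ℕ) → Rel (Vertex n) 0ℓ
C₀ n = SymClosure Edge₀
C₁ n = SymClosure Edge₁

-- Real numbers as Cauchy sequences of rationals

record ℝ : Set where
  constructor mkℝ
  field
    seq    : ℕ → ℚ
    cauchy : ∀ ε → 0ℚ ℚ.< ε →
             ∃[ N ] ∀ j k → N ≤ j → N ≤ k → ℚ.∣ seq j ℚ.- seq k ∣ ℚ.≤ ε

open ℝ public

infix 4 _≤ℝ_ _<ℝ_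

_≤ℝ_ _<ℝ_ : Rel ℝ 0ℓ
p ≤ℝ q = ∀ ε → 0ℚ ℚ.< ε → ∃[ N ] ∀ k → N ≤ k → seq p k ℚ.≤ seq q k ℚ.+ ε
p <ℝ q = ∃[ ε ] 0ℚ ℚ.< ε × ∃[ N ] ∀ k → N ≤ k → seq p k ℚ.+ ε ℚ.≤ seq q k

fromℚ : ℚ → ℝ
fromℚ q = mkℝ (λ _ → q) λ ε ε>0 → 0 , λ _ _ _ _ →
  subst (λ r → ℚ.∣ r ∣ ℚ.≤ ε) (sym (ℚ.+-inverseʳ q)) (ℚ.<⇒≤ ε>0)

fromℕ′ : ℕ → ℝ
fromℕ′ n = fromℚ (ℤ.+ n ℚ./ 1)

private
  module Identities where
    open +-*-Solver

    split-add : ∀ s t → s ≡ t ℚ.+ (s ℚ.- t)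
    split-add = solve 2 (λ s t → s := t :+ (s :- t)) refl

    split-mul : ∀ r s t w →
      r ℚ.* s ℚ.- t ℚ.* w ≡ r ℚ.* (s ℚ.- w) ℚ.+ w ℚ.* (r ℚ.- t)
    split-mul = solve 4 (λ r s t w →
      r :* s :- t :* w := r :* (s :- w) :+ w :* (r :- t)) refl

    gather : ∀ r s e i →
      r ℚ.* (e ℚ.* i) ℚ.+ s ℚ.* (e ℚ.* i) ≡ e ℚ.* (i ℚ.* (r ℚ.+ s))
    gather = solve 4 (λ r s e i →
      r :* (e :* i) :+ s :* (e :* i) := e :* (i :* (r :+ s))) refl

  open Identities

  bounded : (p : ℝ) → ∃[ B ] ℚ.Positive B ×
            ∃[ N ] ∀ k → N ≤ k → ℚ.∣ seq p k ∣ ℚ.≤ B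
  bounded p with cauchy p 1ℚ (ℚ.positive⁻¹ 1ℚ)
  ... | N , close = ℚ.∣ seq p N ∣ ℚ.+ 1ℚ
                  , ℚ.nonNeg+pos⇒pos ℚ.∣ seq p N ∣ {{ℚ.∣-∣-nonNeg (seq p N)}} 1ℚ
                  , N , bound
    where
    open ℚ.≤-Reasoning
    bound : ∀ k → N ≤ k → ℚ.∣ seq p k ∣ ℚ.≤ ℚ.∣ seq p N ∣ ℚ.+ 1ℚ
    bound k N≤k = begin
      ℚ.∣ seq p k ∣
        ≡⟨ cong ℚ.∣_∣ (split-add (seq p k) (seq p N)) ⟩
      ℚ.∣ seq p N ℚ.+ (seq p k ℚ.- seq p N) ∣
        ≤⟨ ℚ.∣p+q∣≤∣p∣+∣q∣ (seq p N) (seq p k ℚ.- seq p N) ⟩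
      ℚ.∣ seq p N ∣ ℚ.+ ℚ.∣ seq p k ℚ.- seq p N ∣
        ≤⟨ ℚ.+-monoʳ-≤ ℚ.∣ seq p N ∣ (close k N N≤k ℕ.≤-refl) ⟩
      ℚ.∣ seq p N ∣ ℚ.+ 1ℚ ∎

  ∣*∣-bound : ∀ r s {A B} → ℚ.Positive A → ℚ.∣ r ∣ ℚ.≤ A → ℚ.∣ s ∣ ℚ.≤ B →
              ℚ.∣ r ℚ.* s ∣ ℚ.≤ A ℚ.* B
  ∣*∣-bound r s {A} {B} A>0 r≤A s≤B = begin
    ℚ.∣ r ℚ.* s ∣           ≡⟨ ℚ.∣p*q∣≡∣p∣*∣q∣ r s ⟩
    ℚ.∣ r ∣ ℚ.* ℚ.∣ s ∣     ≤⟨ ℚ.*-monoʳ-≤-nonNeg ℚ.∣ s ∣ {{ℚ.∣-∣-nonNeg s}} r≤A ⟩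
    A ℚ.* ℚ.∣ s ∣           ≤⟨ ℚ.*-monoˡ-≤-nonNeg A {{ℚ.pos⇒nonNeg A {{A>0}}}} s≤B ⟩
    A ℚ.* B                 ∎
    where open ℚ.≤-Reasoning

  mul-close : ∀ r s t w A B {δ} → ℚ.Positive A → ℚ.Positive B →
    ℚ.∣ r ∣ ℚ.≤ A → ℚ.∣ w ∣ ℚ.≤ B →
    ℚ.∣ s ℚ.- w ∣ ℚ.≤ δ → ℚ.∣ r ℚ.- t ∣ ℚ.≤ δ →
    ℚ.∣ r ℚ.* s ℚ.- t ℚ.* w ∣ ℚ.≤ A ℚ.* δ ℚ.+ B ℚ.* δ
  mul-close r s t w A B {δ} A>0 B>0 r≤A w≤B s-w r-t = begin
    ℚ.∣ r ℚ.* s ℚ.- t ℚ.* w ∣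
      ≡⟨ cong ℚ.∣_∣ (split-mul r s t w) ⟩
    ℚ.∣ r ℚ.* (s ℚ.- w) ℚ.+ w ℚ.* (r ℚ.- t) ∣
      ≤⟨ ℚ.∣p+q∣≤∣p∣+∣q∣ (r ℚ.* (s ℚ.- w)) (w ℚ.* (r ℚ.- t)) ⟩
    ℚ.∣ r ℚ.* (s ℚ.- w) ∣ ℚ.+ ℚ.∣ w ℚ.* (r ℚ.- t) ∣
      ≤⟨ ℚ.+-mono-≤ (∣*∣-bound r (s ℚ.- w) A>0 r≤A s-w)
                    (∣*∣-bound w (r ℚ.- t) B>0 w≤B r-t) ⟩
    A ℚ.* δ ℚ.+ B ℚ.* δ ∎
    where open ℚ.≤-Reasoning

  share : ∀ A B {ε} → ℚ.Positive A → ℚ.Positive B → 0ℚ ℚ.< ε →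
          ∃[ δ ] 0ℚ ℚ.< δ × A ℚ.* δ ℚ.+ B ℚ.* δ ≡ ε
  share A B {ε} A>0 B>0 ε>0 = ε ℚ.* i , δ>0 , sum≡ε
    where
    instance
      D>0 : ℚ.Positive (A ℚ.+ B)
      D>0 = ℚ.pos+pos⇒pos A {{A>0}} B {{B>0}}
      D≢0 : ℚ.NonZero (A ℚ.+ B)
      D≢0 = ℚ.pos⇒nonZero (A ℚ.+ B)
    i : ℚ
    i = ℚ.1/ (A ℚ.+ B)
    δ>0 : 0ℚ ℚ.< ε ℚ.* i
    δ>0 = ℚ.positive⁻¹ (ε ℚ.* i)
      {{ℚ.pos*pos⇒pos ε {{ℚ.positive ε>0}} i {{ℚ.1/pos⇒pos (A ℚ.+ B)}}}}
    sum≡ε : A ℚ.* (ε ℚ.* i) ℚ.+ B ℚ.* (ε ℚ.* i) ≡ ε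
    sum≡ε = trans (gather A B ε i)
           (trans (cong (ε ℚ.*_) (ℚ.*-inverseˡ (A ℚ.+ B))) (ℚ.*-identityʳ ε))

infixl 7 _*ℝ_
infixr 8 _^ℝ_

_*ℝ_ : ℝ → ℝ → ℝ
p *ℝ q = mkℝ (λ k → seq p k ℚ.* seq q k) λ ε ε>0 →
  let A , A>0 , N₁ , p≤A = bounded p
      B , B>0 , N₂ , q≤B = bounded q
      δ , δ>0 , sum≡ε    = share A B A>0 B>0 ε>0
      N₃ , p-close       = cauchy p δ δ>0
      N₄ , q-close       = cauchy q δ δ>0
      N₁≤ = λ {k} (h : (N₁ ⊔ N₂) ⊔ (N₃ ⊔ N₄) ≤ k) →
              ℕ.m⊔n≤o⇒m≤o N₁ N₂ (ℕ.m⊔n≤o⇒m≤o (N₁ ⊔ N₂) (N₃ ⊔ N₄) h)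
      N₂≤ = λ {k} (h : (N₁ ⊔ N₂) ⊔ (N₃ ⊔ N₄) ≤ k) →
              ℕ.m⊔n≤o⇒n≤o N₁ N₂ (ℕ.m⊔n≤o⇒m≤o (N₁ ⊔ N₂) (N₃ ⊔ N₄) h)
      N₃≤ = λ {k} (h : (N₁ ⊔ N₂) ⊔ (N₃ ⊔ N₄) ≤ k) →
              ℕ.m⊔n≤o⇒m≤o N₃ N₄ (ℕ.m⊔n≤o⇒n≤o (N₁ ⊔ N₂) (N₃ ⊔ N₄) h)
      N₄≤ = λ {k} (h : (N₁ ⊔ N₂) ⊔ (N₃ ⊔ N₄) ≤ k) →
              ℕ.m⊔n≤o⇒n≤o N₃ N₄ (ℕ.m⊔n≤o⇒n≤o (N₁ ⊔ N₂) (N₃ ⊔ N₄) h)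
  in (N₁ ⊔ N₂) ⊔ (N₃ ⊔ N₄) , λ j k j≥ k≥ →
       subst (ℚ.∣ seq p j ℚ.* seq q j ℚ.- seq p k ℚ.* seq q k ∣ ℚ.≤_) sum≡ε
         (mul-close (seq p j) (seq q j) (seq p k) (seq q k) A B A>0 B>0
           (p≤A j (N₁≤ j≥)) (q≤B k (N₂≤ k≥))
           (q-close j k (N₄≤ j≥) (N₄≤ k≥))
           (p-close j k (N₃≤ j≥) (N₃≤ k≥)))

_^ℝ_ : ℝ → ℕ → ℝ
r ^ℝ zero  = fromℚ 1ℚ
r ^ℝ suc n = r *ℝ (r ^ℝ n)

-- f ∈ Θ(g), for non-negative g.  Rational constants suffice, as every
-- positive real lies between two positive rationals.
infix 4 _∈Θ_
_∈Θ_ : (f g : ℕ → ℝ) → Set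
f ∈Θ g = ∃[ A ] ∃[ B ] 0ℚ ℚ.< A × 0ℚ ℚ.< B × ∃[ n₀ ] ∀ n → n₀ ≤ n →
  fromℚ A *ℝ g n ≤ℝ f n × f n ≤ℝ fromℚ B *ℝ g n

{-# OPTIONS --safe #-}
module Submission where

-- For each j, the vertices u_i, v_i with i > j form a part of G_n joined to the rest
-- by three edges, with one Hamiltonian path for each pair of these.  Each time the
-- algorithm enters this part, with a path that leaves it at two of the three edges,
-- it exchanges one of the two for the third before it leaves the part again.
-- Removing one gadget expresses the run on this part by at most two runs on the part
-- for j + 1 and at most two lollipops with pivot in the gadget.  Hence the number of
-- lollipops satisfies T (n + 4) = 2 T (n + 1) + T n + 8, and it grows like cⁿ for the
-- root c of c⁴ = 2 c + 1.  This c is approximated from above by bisection: the upper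
-- bound then holds exactly for each approximation, and in the lower bound the error
-- in the equation for c is absorbed by the constant 8.

open import Defs
open import Data.Empty using (⊥-elim)
open import Data.Fin using (Fin; zero; suc; toℕ; fromℕ<)
open import Data.Fin.Properties using (toℕ-fromℕ<; toℕ-fromℕ; toℕ-inject₁; toℕ<n; toℕ≤pred[n])
open import Data.Integer using (+_; +[1+_])
import Data.Integer as ℤ
import Data.Integer.Properties as ℤ
open import Data.List using (List; []; _∷_; [_]; _++_; _∷ʳ_; reverse)
open import Data.List.Membership.Propositional using (_∈_)
open import Data.List.Membership.Propositional.Properties using (∈-++⁺ˡ; ∈-++⁺ʳ)
import Data.List.Properties as List
open import Data.List.Relation.Binary.Permutation.Propositional
  using (_↭_; ↭-sym; ↭-trans; ↭-reflexive; prep; ↭⇒↭ₛ)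
import Data.List.Relation.Binary.Permutation.Propositional.Properties as ↭
import Data.List.Relation.Binary.Permutation.Setoid.Properties as ↭ₛ
open import Data.List.Relation.Unary.All as All using (All; []; _∷_)
open import Data.List.Relation.Unary.All.Properties using () renaming (++⁺ to All-++⁺)
open import Data.List.Relation.Unary.AllPairs using ([]; _∷_)
open import Data.List.Relation.Unary.Any using (here; there)
open import Data.List.Relation.Unary.Linked as Linked using (Linked; []; [-]; _∷_)
open import Data.List.Relation.Unary.Unique.Propositional using (Unique)
open import Data.List.Relation.Unary.Unique.Propositional.Properties
  using () renaming (++⁺ to unique-++⁺)
open import Data.Nat using (ℕ; _≤_)
open import Data.Nat as ℕ using (zero; suc; _+_; _∸_; _<_; pred; z≤n; s≤s; parity)
open import Data.Nat.Properties
  using (≤-refl; ≤-trans; ≤-antisym; ≤-reflexive; m≤m+n; n≤1+n; <⇒≤; <⇒≢; 1+n≢n;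
         +-suc; +-identityʳ; m≤n⇒m≤1+n; m≤n⇒m<n∨m≡n; m+[n∸m]≡n)
import Data.Nat.Properties as ℕ
open import Data.Nat.Tactic.RingSolver using (solve-∀)
open import Data.Parity.Base using (Parity; 0ℙ; 1ℙ; _⁻¹)
open import Data.Parity.Properties using (suc-homo-⁻¹)
open import Data.Product using (_×_; _,_; ∃-syntax; Σ-syntax; proj₁; proj₂)
open import Data.Rational using (1ℚ; _/_)
open import Data.Rational as ℚ using (ℚ; 0ℚ; ½; mkℚ)
import Data.Rational.Properties as ℚ
open import Data.Rational.Solver using (module +-*-Solver)
open import Data.Rational.Unnormalised as ℚᵘ using (mkℚᵘ; *≡*; *≤*)
import Data.Rational.Unnormalised.Properties as ℚᵘ
open import Data.Sum using (_⊎_; inj₁; inj₂)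
open import Function.Bundles using (mk⇔)
open import Level using (0ℓ)
open import Relation.Binary.Construct.Closure.Symmetric as Sym using (SymClosure; fwd; bwd)
open import Relation.Binary.Core using (Rel)
open import Relation.Binary.Definitions using (Symmetric)
open import Relation.Binary.PropositionalEquality
  using (_≡_; _≢_; refl; sym; trans; cong; cong₂; subst; subst₂; ≢-sym; setoid; module ≡-Reasoning)
open import Relation.Nullary using (¬_; yes; no)
open import Relation.Nullary.Decidable using (toWitness)

-- The obstacle is that the remainder of the path behind an excursion varies: it gains gadget
-- vertices and gets reversed. The induction therefore treats it as an arbitrary segment `L`, of
-- which only the adjacency of its two ends to the ports is known. Gadget vertices visited after the
-- smaller part are absorbed into `L`. Separate excursions are required for the case that a flip at
-- a gadget vertex leaves the last vertex of the path inside the smaller part, where no segment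
-- follows. Turning back is excluded locally. A lollipop reverses the tail behind its pivot, and
-- only a lollipop with the same pivot can undo it, so a run is certified by its sequence of pivots,
-- any two consecutive ones being distinct. The degree in `K(G)` is then never computed along the
-- way: the step back and the step forward lead to different paths. Only at the two ends must a
-- second lollipop be excluded, and there the neighbours of the last vertex decide.

-- Lists with prescribed ends, reversal, and lists without repetition

module _ {A : Set} where

  -- The ends occupy separate positions, so `xs` has at least two entries. This yields the non-empty
  -- `mid` of a lollipop, and in a list without repetition it makes the two ends different.
  Span : A → List A → A → Set
  Span a xs b = ∃[ ms ] xs ≡ a ∷ (ms ∷ʳ b)

  span-∷ : ∀ {a b xs} c → Span a xs b → Span c (c ∷ xs) b
  span-∷ {a} c (ms , refl) = a ∷ ms , refl

  span-++ : ∀ {a b c d xs ys} → Span a xs b → Span c ys d → Span a (xs ++ ys) d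
  span-++ {b = b} {c} (ms , refl) (ns , refl) = ms ++ b ∷ c ∷ ns ,
    cong (_ ∷_) (trans (List.++-assoc ms _ _) (sym (List.++-assoc ms _ _)))

  span-∷ʳ : ∀ {a b xs} c → Span a xs b → Span a (xs ∷ʳ c) c
  span-∷ʳ {b = b} c (ms , refl) = ms ∷ʳ b , refl

  reverse-∷-∷ʳ : ∀ (a : A) ms b → reverse (a ∷ (ms ∷ʳ b)) ≡ b ∷ (reverse ms ∷ʳ a)
  reverse-∷-∷ʳ a ms b = trans (List.unfold-reverse a (ms ∷ʳ b))
    (cong (_∷ʳ a) (List.reverse-++ ms [ b ]))

  span-reverse : ∀ {a b xs} → Span a xs b → Span b (reverse xs) a
  span-reverse {a} {b} (ms , refl) = reverse ms , reverse-∷-∷ʳ a ms b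

  reverse-∷ʳ : ∀ (xs : List A) a → reverse (xs ∷ʳ a) ≡ a ∷ reverse xs
  reverse-∷ʳ xs a = List.reverse-++ xs [ a ]

  last-injective : ∀ (xs ys : List A) {a b} → xs ∷ʳ a ≡ ys ∷ʳ b → a ≡ b
  last-injective xs ys = List.∷ʳ-injectiveʳ xs ys

  unique⇒∉ : ∀ {a : A} {xs} → Unique (a ∷ xs) → ¬ a ∈ xs
  unique⇒∉ (a≢ ∷ _) a∈ = All.lookup a≢ a∈ refl

  second : ∀ {a b a′ b′ : A} {xs ys} → _≡_ {A = List A} (a ∷ b ∷ xs) (a′ ∷ b′ ∷ ys) → b ≡ b′
  second refl = refl

  unique-split : ∀ {p : A} I J {X Y} → Unique (I ++ p ∷ X) →
                 I ++ p ∷ X ≡ J ++ p ∷ Y → I ≡ J × X ≡ Y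
  unique-split []      []      _       refl = refl , refl
  unique-split []      (_ ∷ J) un       refl =
    ⊥-elim (unique⇒∉ un (∈-++⁺ʳ J (here refl)))
  unique-split (_ ∷ I) []      un       refl =
    ⊥-elim (unique⇒∉ un (∈-++⁺ʳ I (here refl)))
  unique-split (i ∷ I) (j ∷ J) (_ ∷ un) eq with refl , eq′ ← List.∷-injective eq
    with refl , X≡Y ← unique-split I J un eq′ = refl , X≡Y

  unique-↭ : ∀ {xs ys : List A} → xs ↭ ys → Unique xs → Unique ys
  unique-↭ p = ↭ₛ.Unique-resp-↭ (setoid A) (↭⇒↭ₛ p)

  unique-++ʳ : ∀ (I : List A) {X} → Unique (I ++ X) → Unique X
  unique-++ʳ []      un       = un
  unique-++ʳ (_ ∷ I) (_ ∷ un) = unique-++ʳ I un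

  flip-↭ : ∀ I (p : A) X → I ++ p ∷ X ↭ I ++ p ∷ reverse X
  flip-↭ I p X = ↭.++⁺ˡ I (prep p (↭-sym (↭.↭-reverse X)))

  -- Both equations hold when a flip at p is followed by a flip at q that undoes it;
  -- if I and J have different lengths, they force h ≡ l or k ≡ m.
  flip-flip≢ : ∀ {h k l m p q : A} I J {X X′ Y Y′} → h ≢ l → k ≢ m → p ≢ q →
               I ++ p ∷ l ∷ X′ ≡ J ++ q ∷ k ∷ Y → I ++ p ∷ h ∷ X ≢ J ++ q ∷ m ∷ Y′
  flip-flip≢ [] [] _ _ p≢q eq _ = p≢q (List.∷-injectiveˡ eq)
  flip-flip≢ [] (_ ∷ []) h≢l _ _ eq eq′ = h≢l (trans (second eq′) (sym (second eq)))
  flip-flip≢ [] (_ ∷ _ ∷ _) h≢l _ _ eq eq′ = h≢l (trans (second eq′) (sym (second eq)))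
  flip-flip≢ (_ ∷ []) [] _ k≢m _ eq eq′ = k≢m (trans (sym (second eq)) (second eq′))
  flip-flip≢ (_ ∷ _ ∷ _) [] _ k≢m _ eq eq′ = k≢m (trans (sym (second eq)) (second eq′))
  flip-flip≢ (_ ∷ I) (_ ∷ J) h≢l k≢m p≢q eq eq′ =
    flip-flip≢ I J h≢l k≢m p≢q (List.∷-injectiveʳ eq) (List.∷-injectiveʳ eq′)

  span-ends≢ : ∀ {h l : A} I {p X} → Unique (I ++ p ∷ X) → Span h X l → h ≢ l
  span-ends≢ I un (ms , refl) refl with unique-++ʳ I un
  ... | _ ∷ un′ = unique⇒∉ un′ (∈-++⁺ʳ ms (here refl))

-- Linked lists under concatenation and reversal

module _ {A : Set} {R : Rel A 0ℓ} where

  linked-∷ : ∀ {a b p xs} → Span a xs b → R p a → Linked R xs → Linked R (p ∷ xs)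
  linked-∷ (_ , refl) r rs = r ∷ rs

  linked-++⁻ˡ : ∀ xs {p ys} → Linked R (xs ++ p ∷ ys) → Linked R (xs ∷ʳ p)
  linked-++⁻ˡ []           _        = [-]
  linked-++⁻ˡ (_ ∷ [])     (r ∷ _)  = r ∷ [-]
  linked-++⁻ˡ (_ ∷ _ ∷ xs) (r ∷ rs) = r ∷ linked-++⁻ˡ (_ ∷ xs) rs

  linked-++⁻ʳ : ∀ xs {ys} → Linked R (xs ++ ys) → Linked R ys
  linked-++⁻ʳ []       rs = rs
  linked-++⁻ʳ (_ ∷ xs) rs = linked-++⁻ʳ xs (Linked.tail rs)

  linked-++⁺ : ∀ xs {p ys} → Linked R (xs ∷ʳ p) → Linked R (p ∷ ys) → Linked R (xs ++ p ∷ ys)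
  linked-++⁺ []           _        rs′ = rs′
  linked-++⁺ (_ ∷ [])     (r ∷ _)  rs′ = r ∷ rs′
  linked-++⁺ (_ ∷ _ ∷ xs) (r ∷ rs) rs′ = r ∷ linked-++⁺ (_ ∷ xs) rs rs′

  linked-∷ʳ : ∀ {a b q xs} → Span a xs b → Linked R xs → R b q → Linked R (xs ∷ʳ q)
  linked-∷ʳ {a} {b} {q} (ms , refl) rs r = subst (Linked R) (sym (List.++-assoc (a ∷ ms) [ b ] [ q ]))
    (linked-++⁺ (a ∷ ms) rs (r ∷ [-]))

  linked-reverse : Symmetric R → ∀ {xs} → Linked R xs → Linked R (reverse xs)
  linked-reverse R-sym []  = []
  linked-reverse R-sym [-] = [-]
  linked-reverse R-sym {a ∷ b ∷ xs} (r ∷ rs) =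
    subst (Linked R) (sym (trans (List.unfold-reverse a (b ∷ xs))
      (trans (cong (_∷ʳ a) (List.unfold-reverse b xs)) (List.++-assoc (reverse xs) _ _))))
      (linked-++⁺ (reverse xs)
        (subst (Linked R) (List.unfold-reverse b xs) (linked-reverse R-sym rs))
        (R-sym r ∷ [-]))

  linked-span-++ : ∀ {a b c xs ys} → Span a xs b → Linked R xs → R b c → Linked R (c ∷ ys) →
                   Linked R (xs ++ c ∷ ys)
  linked-span-++ {xs = xs} s rs r rs′ = linked-++⁺ xs (linked-∷ʳ s rs r) rs′

  linked-prefix : ∀ xs {ys} → Linked R (xs ++ ys) → Linked R xs
  linked-prefix []           _        = []
  linked-prefix (_ ∷ [])     _        = [-]
  linked-prefix (_ ∷ _ ∷ xs) (r ∷ rs) = r ∷ linked-prefix (_ ∷ xs) rs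

-- Lollipops as tail reversals, and runs as walks that never turn back

module Flips (G : Graph) where
  open Graph G renaming (Vertex to Node)
  open Lollipops G public

  -- A lollipop in symmetric form. Recording the adjacency of the pivot to both ends of the tail
  -- makes the inverse a flip again, without appeal to the linkedness of the path. The prefix `I`
  -- may be empty: the initial vertex of the path is put in front only in `flip⇒lollipop`.
  record Flip (p : Node) (xs ys : List Node) : Set where
    constructor mkFlip
    field
      I X     : List Node
      {h l}   : Node
      span    : Span h X l
      p~h     : p ~ h
      p~l     : p ~ l
      source  : xs ≡ I ++ p ∷ X
      target  : ys ≡ I ++ p ∷ reverse X

  flip-sym : ∀ {p xs ys} → Flip p xs ys → Flip p ys xs
  flip-sym {p} (mkFlip I X s ph pl refl refl) =
    mkFlip I (reverse X) (span-reverse s) pl ph refl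
      (cong (λ Y → I ++ p ∷ Y) (sym (List.reverse-involutive X)))

  flip-++ : ∀ {p xs ys} zs → Flip p xs ys → Flip p (zs ++ xs) (zs ++ ys)
  flip-++ zs (mkFlip I X s ph pl refl refl) =
    mkFlip (zs ++ I) X s ph pl (sym (List.++-assoc zs I _)) (sym (List.++-assoc zs I _))

  flip-at : ∀ I {h l p X Y} → Span h X l → p ~ h → p ~ l → reverse X ≡ Y →
            Flip p (I ++ p ∷ X) (I ++ p ∷ Y)
  flip-at I s ph pl refl = mkFlip I _ s ph pl refl refl

  -- The two ends of a reversed tail differ, so a flip changes the entry right behind its pivot. Of
  -- two flips at different positions, the one nearer to the start changes such an entry and the
  -- other leaves that entry alone.
  flip-back≢ : ∀ {p q xs ys zs} → Unique xs → Unique ys →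
               Flip p xs ys → Flip q ys zs → p ≢ q → zs ≢ xs
  flip-back≢ {p} {q} un un′ (mkFlip I X s@(_ , refl) _ _ refl refl)
             (mkFlip J Y s′@(_ , refl) _ _ eq refl) p≢q zs≡xs =
    flip-flip≢ I J (span-ends≢ I un s) (span-ends≢ J (subst Unique eq un′) s′) p≢q
      (trans (cong (λ Z → I ++ p ∷ Z) (sym (proj₂ (span-reverse s)))) eq)
      (trans (sym zs≡xs) (cong (λ Z → J ++ q ∷ Z) (proj₂ (span-reverse s′))))

  flip-perm : ∀ {p xs ys} → Flip p xs ys → xs ↭ ys
  flip-perm (mkFlip I X _ _ _ refl refl) = flip-↭ I _ X

  flip-linked : ∀ {p xs ys} → Flip p xs ys → Linked _~_ xs → Linked _~_ ys
  flip-linked (mkFlip I X s _ pl refl refl) lk =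
    linked-++⁺ I (linked-++⁻ˡ I lk)
      (linked-∷ (span-reverse s) pl (linked-reverse ~-sym (Linked.tail (linked-++⁻ʳ I lk))))

  flipped : (P : HamPath) {p : Node} {ys : List Node} → Flip p (verts P) ys → HamPath
  flipped P {ys = ys} f = record
    { verts    = ys
    ; linked   = flip-linked f (linked P)
    ; unique   = unique-↭ (flip-perm f) (unique P)
    ; spanning = λ t → ↭.∈-resp-↭ (flip-perm f) (spanning P t)
    }

  flip⇒lollipop : ∀ {z xs ys p} (P Q : HamPath) → verts P ≡ z ∷ xs → verts Q ≡ z ∷ ys →
                  Flip p xs ys → Lollipop P Q
  flip⇒lollipop {z} P Q eqP eqQ (mkFlip I X {h} {l} (ms , refl) ph pl refl refl) = record
    { init = z ∷ I ; mid = h ∷ ms ; pᵢ = _ ; p_N = l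
    ; init≢[] = λ () ; mid≢[] = λ () ; chord = pl
    ; before = eqP
    ; after = trans eqQ (cong (λ Y → z ∷ I ++ _ ∷ Y) (trans (reverse-∷-∷ʳ h ms l)
        (cong (l ∷_) (sym (List.unfold-reverse h ms)))))
    }

  -- A path of flips which never turns back: consecutive pivots differ.
  data Walk : (s t : Node) → ℕ → (xs ys : List Node) → Set where
    flip : ∀ {s xs ys} → Flip s xs ys → Walk s s 1 xs ys
    cons : ∀ {s s′ t k xs ys zs} → Flip s xs ys → s ≢ s′ → Walk s′ t k ys zs →
           Walk s t (suc k) xs zs

  infixr 5 _⟨_⟩++_
  _⟨_⟩++_ : ∀ {s t s′ t′ j k xs ys zs} → Walk s t j xs ys → t ≢ s′ → Walk s′ t′ k ys zs →
            Walk s t′ (j + k) xs zs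
  flip f        ⟨ ne ⟩++ w′ = cons f ne w′
  cons f ne′ w ⟨ ne ⟩++ w′ = cons f ne′ (w ⟨ ne ⟩++ w′)

  walk-++ : ∀ {s t k xs ys} zs → Walk s t k xs ys → Walk s t k (zs ++ xs) (zs ++ ys)
  walk-++ zs (flip f)         = flip (flip-++ zs f)
  walk-++ zs (cons f ne w) = cons (flip-++ zs f) ne (walk-++ zs w)

  private
    snoc : ∀ {s t t′ k xs ys zs} → Walk s t k xs ys → t ≢ t′ → Flip t′ ys zs →
           Walk s t′ (suc k) xs zs
    snoc (flip f)          ne f′ = cons f ne (flip f′)
    snoc (cons f ne′ w) ne f′ = cons f ne′ (snoc w ne f′)

  walk-sym : ∀ {s t k xs ys} → Walk s t k xs ys → Walk t s k ys xs
  walk-sym (flip f)         = flip (flip-sym f)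
  walk-sym (cons f ne w) = snoc (walk-sym w) (≢-sym ne) (flip-sym f)

  -- The uniqueness half of `DegreeOne`; for the two ends of a run, existence comes from the first
  -- and the last flip of the walk.
  AtMostOne : HamPath → Set
  AtMostOne P = ∀ {Q Q′} → Lollipop P Q → Lollipop P Q′ → Q ≈ Q′

  two-lollipops : ∀ {P Q R} → Lollipop Q P → Lollipop Q R → ¬ R ≈ P → ¬ DegreeOne Q
  two-lollipops l l′ R≉P (_ , _ , only) = R≉P (trans (sym (only l′)) (only l))

  lollipops : ∀ {z xs ys p} (P : HamPath) → verts P ≡ z ∷ xs → Flip p xs ys →
              ∃[ Q ] verts Q ≡ z ∷ ys × Lollipop P Q × Lollipop Q P
  lollipops {z} {ys = ys} {p} P eqP f =
    Q , refl , flip⇒lollipop P Q eqP refl f , flip⇒lollipop Q P refl eqP (flip-sym f)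
    where
    Q : HamPath
    Q = flipped P (subst (λ w → Flip p w (z ∷ ys)) (sym eqP) (flip-++ (z ∷ []) f))

  no-return : ∀ {z xs ys zs p q} (P Q R : HamPath) →
              verts P ≡ z ∷ xs → verts Q ≡ z ∷ ys → verts R ≡ z ∷ zs →
              Flip p xs ys → Flip q ys zs → p ≢ q → ¬ R ≈ P
  no-return {z} P Q R eqP eqQ eqR f f′ p≢q R≈P =
    flip-back≢ (tail-unique P eqP) (tail-unique Q eqQ) f f′ p≢q
      (List.∷-injectiveʳ (trans (sym eqR) (trans R≈P eqP)))
    where
    tail-unique : ∀ S {vs} → verts S ≡ z ∷ vs → Unique vs
    tail-unique S eq with _ ∷ un ← subst Unique eq (unique S) = un

  -- The flip `f` that led from `P` to `Q` is kept because its pivot differs from the next one. So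
  -- the next path is not `P`, which proves at once that the algorithm does not move back and that
  -- `Q` has not degree one.
  continue : ∀ {z s s′ t k xs ys zs} (P Q : HamPath) → verts P ≡ z ∷ xs → verts Q ≡ z ∷ ys →
             Lollipop Q P → Flip s xs ys → s ≢ s′ → Walk s′ t k ys zs →
             (∀ S → verts S ≡ z ∷ zs → AtMostOne S) →
             ∃[ S ] verts S ≡ z ∷ zs × Continue P Q k S
  continue P Q eqP eqQ back f ne (flip f′) end with lollipops Q eqQ f′
  ... | R , eqR , to , from = R , eqR ,
    step (two-lollipops back to R≉P) to R≉P (stop (Q , from , end R eqR from))
    where
    R≉P : ¬ R ≈ P
    R≉P = no-return P Q R eqP eqQ eqR f f′ ne
  continue P Q eqP eqQ back f ne (cons f′ ne′ w) end with lollipops Q eqQ f′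
  ... | R , eqR , to , from with continue Q R eqQ eqR from f′ ne′ w end
  ...   | S , eqS , c = S , eqS , step (two-lollipops back to R≉P) to R≉P c
    where
    R≉P : ¬ R ≈ P
    R≉P = no-return P Q R eqP eqQ eqR f f′ ne

  run : ∀ {z s t k xs ys} (P : HamPath) → verts P ≡ z ∷ xs → AtMostOne P →
        Walk s t k xs ys → (∀ S → verts S ≡ z ∷ ys → AtMostOne S) → xs ≢ ys →
        ∃[ S ] verts S ≡ z ∷ ys × Run P k S
  run {z} {xs = xs} {ys} P eqP first w end xs≢ys = go w
    where
    differ : ∀ S → verts S ≡ z ∷ ys → ¬ S ≈ P
    differ S eqS S≈P = xs≢ys (List.∷-injectiveʳ (trans (sym eqP) (trans (sym S≈P) eqS)))
    go : ∀ {s t k} → Walk s t k xs ys → ∃[ S ] verts S ≡ z ∷ ys × Run P k S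
    go (flip f) with lollipops P eqP f
    ... | Q , eqQ , to , from = Q , eqQ ,
      start (Q , to , first to) to (stop (P , from , end Q eqQ from)) (differ Q eqQ)
    go (cons f ne w′) with lollipops P eqP f
    ... | Q , eqQ , to , from with continue P Q eqP eqQ from f ne w′ end
    ...   | S , eqS , c = S , eqS , start (Q , to , first to) to c (differ S eqS)

  pivot-determines : ∀ {P Q Q′} (L : Lollipop P Q) (L′ : Lollipop P Q′) →
    Lollipop.pᵢ L ≡ Lollipop.pᵢ L′ → Lollipop.p_N L ≡ Lollipop.p_N L′ → Q ≈ Q′
  pivot-determines {P} record { init = i ; mid = m ; before = b ; after = a }
                       record { init = i′ ; mid = m′ ; before = b′ ; after = a′ } refl refl
    with refl , eq ← unique-split i i′ (subst Unique b (unique P)) (trans (sym b) b′)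
    with refl ← List.∷ʳ-injectiveˡ m m′ eq = trans a (sym a′)

  -- Of the three neighbours of the last vertex, the initial vertex `z` is no pivot because `init`
  -- is non-empty, and the predecessor `w` is none because `mid` is non-empty. Only `t` remains.
  atMostOne : ∀ {z xs w l t} (P : HamPath) → verts P ≡ z ∷ xs →
              ∃[ ys ] verts P ≡ ys ++ w ∷ l ∷ [] →
              (∀ s → s ~ l → s ≡ z ⊎ s ≡ w ⊎ s ≡ t) → AtMostOne P
  atMostOne {z} {xs} {w} {l} {t} P eqP (ys , eqP′) nbrs {Q} {Q′} L L′ =
    pivot-determines L L′ (trans (proj₁ (pivot L)) (sym (proj₁ (pivot L′))))
      (trans (proj₂ (pivot L)) (sym (proj₂ (pivot L′))))
    where
    un : ∀ {vs} → verts P ≡ vs → Unique vs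
    un eq = subst Unique eq (unique P)
    pivot : ∀ {R} → (L : Lollipop P R) → Lollipop.pᵢ L ≡ t × Lollipop.p_N L ≡ l
    pivot record { init = i ; mid = m ; init≢[] = i≢ ; mid≢[] = m≢ ; p_N = pN ; chord = c ; before = b }
      with refl ← last-injective (i ++ _ ∷ m) (ys ++ [ w ])
             (trans (List.++-assoc i _ _) (trans (sym b) (trans eqP′ (sym (List.++-assoc ys _ _)))))
      with nbrs _ c
    ... | inj₁ refl = ⊥-elim (i≢ (sym (proj₁ (unique-split [] i (un eqP) (trans (sym eqP) b)))))
    ... | inj₂ (inj₁ refl) with unique-split ys i (un eqP′) (trans (sym eqP′) b)
    ...   | _ , eq = ⊥-elim (m≢ (List.∷ʳ-injectiveˡ m [] (sym eq)))
    pivot _ | inj₂ (inj₂ refl) = refl , refl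

-- Numerical subscripts and the nested parts of the graph

-- Values k > m are sent to the last element.
clamp : ∀ {m} → ℕ → Fin (suc m)
clamp         zero    = zero
clamp {zero}  (suc k) = zero
clamp {suc m} (suc k) = suc (clamp k)

toℕ-clamp : ∀ {m k} → k ≤ m → toℕ (clamp {m} k) ≡ k
toℕ-clamp z≤n     = refl
toℕ-clamp (s≤s l) = cong suc (toℕ-clamp l)

clamp-toℕ : ∀ {m k} (i : Fin (suc m)) → toℕ i ≡ k → clamp k ≡ i
clamp-toℕ         zero    refl = refl
clamp-toℕ {suc m} (suc i) refl = cong suc (clamp-toℕ i refl)

data Ports : Set where
  αβ βα αγ γα βγ γβ : Ports

opposite : Ports → Ports
opposite αβ = βα
opposite βα = αβ
opposite αγ = γα
opposite γα = αγ
opposite βγ = γβ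
opposite γβ = βγ

-- The sums repeat, in order and bracketing, the chains of flips and excursions in the corresponding
-- tours, so that the lengths agree by computation.
lengthβ lengthα lengthγ lengthIβ lengthIγ : ℕ → ℕ
lengthβ zero     = 3
lengthβ (suc m)  = 1 + (lengthIβ m + (1 + lengthα m))
lengthα zero     = 3
lengthα (suc m)  = lengthγ m + (1 + (lengthIβ m + 1))
lengthγ zero     = 3
lengthγ (suc m)  = 1 + (lengthβ m + 1)
lengthIβ zero    = 1
lengthIβ (suc m) = lengthIγ m + 1
lengthIγ zero    = 1
lengthIγ (suc m) = lengthβ m

module Ladder (n : ℕ) where
  open Graph (G n) using (_~_; ~-sym; ~-irref) public

  U V : ℕ → Vertex n
  U k = u (clamp k)
  V k = v (clamp (suc k))

  -- The subscript of the vertex, except that Λ, whose subscript is -1, gets rank 0. Thus the cap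
  -- consists of the vertices of rank 0.
  rank : Vertex n → ℕ
  rank (u i) = toℕ i
  rank (v i) = pred (toℕ i)

  rank-U : ∀ {k} → k ≤ 2 + n → rank (U k) ≡ k
  rank-U = toℕ-clamp

  rank-V : ∀ {k} → k ≤ 1 + n → rank (V k) ≡ k
  rank-V k≤ = toℕ-clamp k≤

  inside-u≡ : ∀ i → inside-u i ≡ U (suc (toℕ i))
  inside-u≡ i = cong u (sym (clamp-toℕ _ (cong suc (trans (toℕ-inject₁ _) (toℕ-inject₁ i)))))

  inside-v≡ : ∀ i → inside-v i ≡ V (suc (toℕ i))
  inside-v≡ i = cong v (sym (clamp-toℕ _ (cong (λ k → suc (suc k)) (toℕ-inject₁ i))))

  uv-u≡ : ∀ i → uv-u i ≡ U (toℕ i)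
  uv-u≡ i = cong u (sym (clamp-toℕ _ (trans (toℕ-inject₁ _) (toℕ-inject₁ i))))

  uv-v≡ : ∀ i → uv-v i ≡ V (suc (toℕ i))
  uv-v≡ i = cong v (sym (clamp-toℕ _ refl))

  vu-v≡ : ∀ i → vu-v (suc i) ≡ V (toℕ i)
  vu-v≡ i = cong v (sym (clamp-toℕ _ (cong suc (toℕ-inject₁ i))))

  vu-u≡ : ∀ i → vu-u i ≡ U (suc (toℕ i))
  vu-u≡ i = cong u (sym (clamp-toℕ _ refl))

  a≡ : a ≡ V (suc n)
  a≡ = cong v (sym (clamp-toℕ _ (toℕ-fromℕ (2 + n))))

  c′≡ : c′ ≡ U (suc n)
  c′≡ = cong u (sym (clamp-toℕ _ (trans (toℕ-inject₁ _) (toℕ-fromℕ (1 + n)))))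

  b≡ : b ≡ U (2 + n)
  b≡ = cong u (sym (clamp-toℕ _ (toℕ-fromℕ (2 + n))))

  module _ (R : Rel (Vertex n) 0ℓ) where

    -- The equation `toℕ i ≡ j` is passed on so that the parity conditions of `Edge₁` can be
    -- restated for `j`. An arbitrary `R` covers adjacency and both cycles.
    at-inside : ∀ {j} → (∀ i → toℕ i ≡ j → R (inside-u i) (inside-v i)) → j < n →
                R (U (suc j)) (V (suc j))
    at-inside {j} r j<n with toℕ-fromℕ< j<n
    ... | eq = subst (λ k → R (U (suc k)) (V (suc k))) eq
                 (subst₂ R (inside-u≡ _) (inside-v≡ _) (r (fromℕ< j<n) eq))

    at-uv : ∀ {j} → (∀ i → R (uv-u i) (uv-v i)) → j ≤ n → R (U j) (V (suc j))
    at-uv r j≤n = subst (λ k → R (U k) (V (suc k))) (toℕ-fromℕ< (s≤s j≤n))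
      (subst₂ R (uv-u≡ _) (uv-v≡ _) (r (fromℕ< (s≤s j≤n))))

    at-vu : ∀ {j} → (∀ i → toℕ i ≡ suc j → R (vu-v i) (vu-u i)) → j ≤ n → R (V j) (U (2 + j))
    at-vu r j≤n with toℕ-fromℕ< (s≤s j≤n)
    ... | eq = subst (λ k → R (V k) (U (2 + k))) eq
                 (subst₂ R (vu-v≡ _) (vu-u≡ _) (r (suc (fromℕ< (s≤s j≤n))) (cong suc eq)))

  U~V : ∀ {j} → j < n → U (suc j) ~ V (suc j)
  U~V = at-inside _~_ (λ i _ → fwd (inside i))

  U~V⁺ : ∀ {j} → j ≤ n → U j ~ V (suc j)
  U~V⁺ = at-uv _~_ (λ i → fwd (uv i))

  V~U⁺ : ∀ {j} → j ≤ n → V j ~ U (2 + j)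
  V~U⁺ = at-vu _~_ (λ i _ → fwd (vu i))

  a~b : V (suc n) ~ U (2 + n)
  a~b = subst₂ _~_ a≡ b≡ (fwd ab)

  a~c′ : V (suc n) ~ U (suc n)
  a~c′ = subst₂ _~_ a≡ c′≡ (fwd ac′)

  b~c′ : U (2 + n) ~ U (suc n)
  b~c′ = subst₂ _~_ b≡ c′≡ (fwd bc′)

  -- The vertices of rank > j are joined to the others by three edges, at the ports
  -- α = v_{j+1}, β = u_{j+1} and γ = u_{j+2}; for m = n - j, H pq j m is the
  -- Hamiltonian path of this part of G n from port p to port q.
  H : Ports → ℕ → ℕ → List (Vertex n)
  H αβ j zero    = V (suc j) ∷ U (2 + j) ∷ U (suc j) ∷ []
  H βα j zero    = U (suc j) ∷ U (2 + j) ∷ V (suc j) ∷ []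
  H αγ j zero    = V (suc j) ∷ U (suc j) ∷ U (2 + j) ∷ []
  H γα j zero    = U (2 + j) ∷ U (suc j) ∷ V (suc j) ∷ []
  H βγ j zero    = U (suc j) ∷ V (suc j) ∷ U (2 + j) ∷ []
  H γβ j zero    = U (2 + j) ∷ V (suc j) ∷ U (suc j) ∷ []
  H αβ j (suc m) = V (suc j) ∷ (H γα (suc j) m ∷ʳ U (suc j))
  H βα j (suc m) = U (suc j) ∷ (H αγ (suc j) m ∷ʳ V (suc j))
  H αγ j (suc m) = V (suc j) ∷ U (suc j) ∷ H αβ (suc j) m
  H γα j (suc m) = H βα (suc j) m ++ U (suc j) ∷ V (suc j) ∷ []
  H βγ j (suc m) = U (suc j) ∷ V (suc j) ∷ H γβ (suc j) m
  H γβ j (suc m) = H βγ (suc j) m ++ V (suc j) ∷ U (suc j) ∷ []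

  source target : Ports → ℕ → Vertex n
  source αβ j = V (suc j)
  source αγ j = V (suc j)
  source βα j = U (suc j)
  source βγ j = U (suc j)
  source γα j = U (2 + j)
  source γβ j = U (2 + j)
  target d = source (opposite d)

  span-H : ∀ d j m → Span (source d j) (H d j m) (target d j)
  span-H αβ j zero    = [ U (2 + j) ] , refl
  span-H βα j zero    = [ U (2 + j) ] , refl
  span-H αγ j zero    = [ U (suc j) ] , refl
  span-H γα j zero    = [ U (suc j) ] , refl
  span-H βγ j zero    = [ V (suc j) ] , refl
  span-H γβ j zero    = [ V (suc j) ] , refl
  span-H αβ j (suc m) = H γα (suc j) m , refl
  span-H βα j (suc m) = H αγ (suc j) m , refl
  span-H αγ j (suc m) = span-∷ _ (span-∷ (U (suc j)) (span-H αβ (suc j) m))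
  span-H γα j (suc m) = span-++ (span-H βα (suc j) m) ([] , refl)
  span-H βγ j (suc m) = span-∷ _ (span-∷ (V (suc j)) (span-H γβ (suc j) m))
  span-H γβ j (suc m) = span-++ (span-H βγ (suc j) m) ([] , refl)

  reverse-H : ∀ d j m → reverse (H d j m) ≡ H (opposite d) j m
  reverse-H αβ j zero    = refl
  reverse-H βα j zero    = refl
  reverse-H αγ j zero    = refl
  reverse-H γα j zero    = refl
  reverse-H βγ j zero    = refl
  reverse-H γβ j zero    = refl
  reverse-H αβ j (suc m) = trans (reverse-∷-∷ʳ _ (H γα (suc j) m) _)
    (cong (λ xs → _ ∷ (xs ∷ʳ _)) (reverse-H γα (suc j) m))
  reverse-H βα j (suc m) = trans (reverse-∷-∷ʳ _ (H αγ (suc j) m) _)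
    (cong (λ xs → _ ∷ (xs ∷ʳ _)) (reverse-H αγ (suc j) m))
  reverse-H αγ j (suc m) = trans (List.reverse-++ (V (suc j) ∷ U (suc j) ∷ []) (H αβ (suc j) m))
    (cong (_++ _) (reverse-H αβ (suc j) m))
  reverse-H γα j (suc m) = trans (List.reverse-++ (H βα (suc j) m) _)
    (cong (λ xs → _ ∷ _ ∷ xs) (reverse-H βα (suc j) m))
  reverse-H βγ j (suc m) = trans (List.reverse-++ (U (suc j) ∷ V (suc j) ∷ []) (H γβ (suc j) m))
    (cong (_++ _) (reverse-H γβ (suc j) m))
  reverse-H γβ j (suc m) = trans (List.reverse-++ (H βγ (suc j) m) _)
    (cong (λ xs → _ ∷ _ ∷ xs) (reverse-H βγ (suc j) m))

  open Flips (G n) public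

  -- Joining walks requires only that the two pivots at the seam differ. Their ranks suffice to tell
  -- them apart, so nothing else is recorded about the outer pivots.
  record Tour (A B : ℕ → Set) (len : ℕ) (xs ys : List (Vertex n)) : Set where
    constructor mkTour
    field
      {first final} : Vertex n
      walk          : Walk first final len xs ys
      first∈A       : A (rank first)
      final∈B       : B (rank final)

  Above Exactly AtLeast : ℕ → ℕ → Set
  Above k i   = k < i
  Exactly k i = i ≡ k
  AtLeast k i = k ≤ i

  tour-++ : ∀ {A B len xs ys} zs → Tour A B len xs ys → Tour A B len (zs ++ xs) (zs ++ ys)
  tour-++ zs (mkTour w p q) = mkTour (walk-++ zs w) p q

  tour-sym : ∀ {A B len xs ys} → Tour A B len xs ys → Tour B A len ys xs
  tour-sym (mkTour w p q) = mkTour (walk-sym w) q p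

  tour-map : ∀ {A A′ B B′ : ℕ → Set} {len xs ys} → (∀ {i} → A i → A′ i) → (∀ {i} → B i → B′ i) →
             Tour A B len xs ys → Tour A′ B′ len xs ys
  tour-map f g (mkTour w p q) = mkTour w (f p) (g q)

  flip-tour : ∀ {k s xs ys} → rank s ≡ k → Flip s xs ys → Tour (Exactly k) (Exactly k) 1 xs ys
  flip-tour eq f = mkTour (flip f) eq eq

  -- In a tour of the vertices of rank ≥ k, excursions to rank > k alternate with
  -- flips at the two vertices of rank k, so that no flip is undone.
  infixr 5 _↑_ _↓_
  _↑_ : ∀ {A B k l l′ xs ys zs} → Tour A (Exactly k) l xs ys → Tour (Above k) B l′ ys zs →
        Tour A B (l + l′) xs zs
  mkTour w p eq ↑ mkTour w′ lt q = mkTour (w ⟨ (λ { refl → <⇒≢ lt (sym eq) }) ⟩++ w′) p q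

  _↓_ : ∀ {A B k l l′ xs ys zs} → Tour A (Above k) l xs ys → Tour (Exactly k) B l′ ys zs →
        Tour A B (l + l′) xs zs
  mkTour w p lt ↓ mkTour w′ eq q = mkTour (w ⟨ (λ { refl → <⇒≢ lt (sym eq) }) ⟩++ w′) p q

  infixr 4 _≡⟫_ _⟫≡_
  _≡⟫_ : ∀ {A B l xs xs′ ys} → xs ≡ xs′ → Tour A B l xs′ ys → Tour A B l xs ys
  refl ≡⟫ t = t
  _⟫≡_ : ∀ {A B l xs ys ys′} → Tour A B l xs ys → ys ≡ ys′ → Tour A B l xs ys′
  t ⟫≡ refl = t

  -- The pac is a triangle, so one computation serves all three entry ports. The pivots are `r`,
  -- `p`, `q`; the lists in between are `p`, `r`, `reverse L`, `q` and then `p`, `q`, `L`, `r`.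
  base : ∀ {k p q r g e L} → p ~ q → q ~ r → r ~ p → Span g L e → q ~ g → r ~ e →
         k ≤ rank q → k ≤ rank r →
         Tour (AtLeast k) (AtLeast k) 3 (p ∷ r ∷ q ∷ L) (p ∷ q ∷ r ∷ reverse L)
  base {p = p} {q} {r} {L = L} pq qr rp s qg re kq kr =
    mkTour (cons (flip-at [ p ] (span-∷ q s) (~-sym qr) re (List.unfold-reverse q L))
             (λ r≡p → ~-irref r≡p rp)
           (cons (flip-at [] (span-∷ r (span-∷ʳ q (span-reverse s))) (~-sym rp) pq eq)
             (λ p≡q → ~-irref p≡q pq)
           (flip (flip-at [ p ] (span-∷ʳ r s) qg qr (reverse-∷ʳ L r)))))
      kr kq
    where
    eq : reverse (r ∷ (reverse L ∷ʳ q)) ≡ q ∷ (L ∷ʳ r)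
    eq = trans (reverse-∷-∷ʳ r (reverse L) q)
      (cong (λ X → q ∷ (X ∷ʳ r)) (List.reverse-involutive L))

  level<n : ∀ {j m} → j + suc m ≡ n → j < n
  level<n {j} {m} eq = ≤-trans (s≤s (m≤m+n j m)) (≤-reflexive (trans (sym (+-suc j m)) eq))

  next : ∀ {j m} → j + suc m ≡ n → suc j + m ≡ n
  next {j} {m} eq = trans (sym (+-suc j m)) eq

  bottom : ∀ {j} → j + 0 ≡ n → j ≡ n
  bottom {j} eq = trans (sym (+-identityʳ j)) eq

  remaining : ∀ {j} → j < n → ∃[ m ] j + suc m ≡ n
  remaining {j} j<n = n ∸ suc j , trans (+-suc j _) (m+[n∸m]≡n j<n)

  private
    module At {j m : ℕ} (eq : j + suc m ≡ n) where
      j<n : j < n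
      j<n = level<n eq
      p q : Vertex n
      p = U (suc j)
      q = V (suc j)
      p~q : p ~ q
      p~q = U~V j<n
      p~α′ : p ~ V (2 + j)
      p~α′ = U~V⁺ j<n
      q~γ′ : q ~ U (3 + j)
      q~γ′ = V~U⁺ j<n
      rank-p : rank p ≡ suc j
      rank-p = rank-U (s≤s (m≤n⇒m≤1+n (<⇒≤ j<n)))
      rank-q : rank q ≡ suc j
      rank-q = rank-V (s≤s (<⇒≤ j<n))
      exact : ∀ {i} → Exactly (suc j) i → suc j ≤ i
      exact eq = ≤-reflexive (sym eq)

  open ≡-Reasoning

  -- The excursions into a part, by recursion on the number of gadgets

  Excursion : ℕ → ℕ → (xs ys : List (Vertex n)) → Set
  Excursion j = Tour (AtLeast (suc j)) (AtLeast (suc j))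

  -- In tourp, a path arrives at the port p, leaves at one of the two other ports and
  -- ends with the segment L, which both of these ports can be connected to.  In
  -- tourIp, the path stops at one of the two other ports.
  tourβ  : ∀ m j → j + m ≡ n → ∀ {g e L} → Span g L e → U (2 + j) ~ g → V (suc j) ~ e →
           Excursion j (lengthβ m) (H βγ j m ++ L) (H βα j m ++ reverse L)
  tourα  : ∀ m j → j + m ≡ n → ∀ {g e L} → Span g L e → U (suc j) ~ g → U (2 + j) ~ e →
           Excursion j (lengthα m) (H αβ j m ++ L) (H αγ j m ++ reverse L)
  tourγ  : ∀ m j → j + m ≡ n → ∀ {g e L} → Span g L e → V (suc j) ~ g → U (suc j) ~ e →
           Excursion j (lengthγ m) (H γα j m ++ L) (H γβ j m ++ reverse L)
  tourIβ : ∀ m j → j + m ≡ n → Excursion j (lengthIβ m) (H βγ j m) (H βα j m)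
  tourIγ : ∀ m j → j + m ≡ n → Excursion j (lengthIγ m) (H γβ j m) (H γα j m)

  tourβ zero j eq s qg re rewrite bottom eq =
    base (~-sym b~c′) (~-sym a~b) a~c′ s qg re
      (≤-trans (n≤1+n _) (≤-reflexive (sym (rank-U ≤-refl)))) (≤-reflexive (sym (rank-V ≤-refl)))
  tourβ (suc m) j eq {L = L} s qg re =
    tour-map exact <⇒≤
      ( flip-tour rank-q (flip-at [ p ] (span-++ (span-H γβ _ m) s) q~γ′ re
          (trans (List.reverse-++ (H γβ _ m) L) (cong (reverse L ++_) (reverse-H γβ _ m))))
      -- The flip at `q` has moved `L` in front of the smaller part, in which the path now ends.
      ↑ tour-++ (p ∷ q ∷ reverse L) (tourIβ m (suc j) (next eq))
      ↓ flip-tour rank-p (flip-at [] (span-∷ q (span-++ (span-reverse s) (span-H βα _ m))) p~q p~α′ eq′)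
      -- Now `q` is last and extends the segment to `L ∷ʳ q`. The port γ of this part is the port β
      -- of the smaller one, so `qg` applies again.
      ↑ (tour-++ [ p ] (tourα m (suc j) (next eq) (span-∷ʳ q s) qg (~-sym q~γ′))
      ⟫≡ eq″))
    where
    open At eq
    eq′ : reverse (q ∷ reverse L ++ H βα (suc j) m) ≡ H αβ (suc j) m ++ (L ∷ʳ q)
    eq′ = begin
      reverse (q ∷ reverse L ++ H βα (suc j) m)
        ≡⟨ List.unfold-reverse q (reverse L ++ H βα (suc j) m) ⟩
      reverse (reverse L ++ H βα (suc j) m) ∷ʳ q
        ≡⟨ cong (_∷ʳ q) (List.reverse-++ (reverse L) (H βα (suc j) m)) ⟩
      (reverse (H βα (suc j) m) ++ reverse (reverse L)) ∷ʳ q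
        ≡⟨ cong₂ (λ X Y → (X ++ Y) ∷ʳ q) (reverse-H βα (suc j) m) (List.reverse-involutive L) ⟩
      (H αβ (suc j) m ++ L) ∷ʳ q
        ≡⟨ List.++-assoc (H αβ (suc j) m) L [ q ] ⟩
      H αβ (suc j) m ++ (L ∷ʳ q) ∎
    eq″ : p ∷ H αγ (suc j) m ++ reverse (L ∷ʳ q) ≡ p ∷ (H αγ (suc j) m ∷ʳ q) ++ reverse L
    eq″ = cong (p ∷_) (trans (cong (H αγ (suc j) m ++_) (reverse-∷ʳ L q))
      (sym (List.++-assoc (H αγ (suc j) m) [ q ] (reverse L))))

  tourα zero j eq s qg re rewrite bottom eq =
    base a~c′ (~-sym b~c′) (~-sym a~b) s qg re
      (≤-reflexive (sym (rank-U (n≤1+n _)))) (≤-trans (n≤1+n _) (≤-reflexive (sym (rank-U ≤-refl))))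
  tourα (suc m) j eq {L = L} s qg re =
    tour-map <⇒≤ exact
      ( cong (q ∷_) (List.++-assoc (H γα _ m) [ p ] L)
      ≡⟫ tour-++ [ q ] (tourγ m (suc j) (next eq) (span-∷ p s) (~-sym p~α′) re)
      ↓ flip-tour rank-q (flip-at [] (span-++ (span-H γβ _ m) (span-reverse (span-∷ p s))) q~γ′ (~-sym p~q)
          (trans (List.reverse-++ (H γβ _ m) (reverse (p ∷ L)))
            (cong₂ _++_ (List.reverse-involutive (p ∷ L)) (reverse-H γβ _ m))))
      ↑ tour-++ (q ∷ p ∷ L) (tourIβ m (suc j) (next eq))
      ↓ flip-tour rank-p (flip-at [ q ] (span-++ s (span-H βα _ m)) qg p~α′
          (trans (List.reverse-++ L (H βα _ m)) (cong (_++ reverse L) (reverse-H βα _ m)))))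
    where open At eq

  tourγ zero j eq s qg re rewrite bottom eq =
    base (~-sym a~b) a~c′ (~-sym b~c′) s qg re
      (≤-reflexive (sym (rank-V ≤-refl))) (≤-reflexive (sym (rank-U (n≤1+n _))))
  tourγ (suc m) j eq {L = L} s qg re =
    tour-map exact exact
      ( List.++-assoc (H βα _ m) (p ∷ q ∷ []) L
      ≡⟫ flip-tour rank-p (flip-at (H βα _ m) (span-∷ q s) p~q re refl)
      -- Here β is the entry and the exit changes from α to γ, so `tourβ` is run backwards, with the
      -- segment `q ∷ (L ∷ʳ p)`.
      ↑ (cong (H βα _ m ++_) (sym (List.reverse-involutive (p ∷ reverse (q ∷ L))))
        ≡⟫ tour-sym (tourβ m (suc j) (next eq) (span-reverse (span-∷ p (span-reverse (span-∷ q s))))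
             (~-sym q~γ′) (~-sym p~α′)))
      ↓ (cong (H βγ _ m ++_) eq′
      ≡⟫ flip-tour rank-q (flip-at (H βγ _ m) (span-∷ʳ p s) qg (~-sym p~q) (reverse-∷ʳ L p))
      ⟫≡ sym (List.++-assoc (H βγ _ m) (q ∷ p ∷ []) (reverse L))))
    where
    open At eq
    eq′ : reverse (p ∷ reverse (q ∷ L)) ≡ q ∷ (L ∷ʳ p)
    eq′ = trans (List.unfold-reverse p (reverse (q ∷ L))) (cong (_∷ʳ p) (List.reverse-involutive (q ∷ L)))

  tourIβ zero j eq rewrite bottom eq =
    tour-map exact exact (flip-tour (rank-U (n≤1+n _)) (flip-at [] ([] , refl) (~-sym a~c′) (~-sym b~c′) refl))
    where
    exact : ∀ {i} → Exactly (suc n) i → suc n ≤ i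
    exact e = ≤-reflexive (sym e)
  tourIβ (suc m) j eq =
    tour-map <⇒≤ exact
      ( tour-++ (p ∷ q ∷ []) (tourIγ m (suc j) (next eq))
      ↓ flip-tour rank-p (flip-at [] (span-∷ q (span-H γα _ m)) p~q p~α′
          (trans (List.unfold-reverse q (H γα _ m)) (cong (_∷ʳ q) (reverse-H γα _ m)))))
    where open At eq

  tourIγ zero j eq rewrite bottom eq =
    tour-map above above (flip-tour (rank-U ≤-refl) (flip-at [] ([] , refl) (~-sym a~b) b~c′ refl))
    where
    above : ∀ {i} → Exactly (2 + n) i → suc n ≤ i
    above e = ≤-trans (n≤1+n _) (≤-reflexive (sym e))
  -- The path stops at a gadget vertex, and the two gadget vertices themselves form the segment `L`.
  tourIγ (suc m) j eq = tour-map <⇒≤ <⇒≤ (tourβ m (suc j) (next eq) ([] , refl) (~-sym q~γ′) (~-sym p~α′))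
    where open At eq

-- The first and last paths follow the two cycles

module Cycles (n : ℕ) where
  open Ladder n

  Adj : List (Vertex n) → Rel (Vertex n) 0ℓ
  Adj xs = SymClosure (Consecutive xs)

  Adj-sym : ∀ {xs} → Symmetric (Adj xs)
  Adj-sym = Sym.symmetric _

  adj-++ : ∀ zs {xs} ys {s t} → Adj xs s t → Adj (zs ++ xs ++ ys) s t
  adj-++ zs ys = Sym.map λ { (A , B , refl) →
    zs ++ A , B ++ ys , trans (cong (zs ++_) (List.++-assoc A _ ys)) (sym (List.++-assoc zs A _)) }

  adj-++ˡ : ∀ zs {xs s t} → Adj xs s t → Adj (zs ++ xs) s t
  adj-++ˡ zs {xs} r = subst (λ X → Adj (zs ++ X) _ _) (List.++-identityʳ xs) (adj-++ zs [] r)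

  adj-reverse : ∀ {xs s t} → Adj xs s t → Adj (reverse xs) s t
  adj-reverse = λ { (fwd (A , B , refl)) → bwd (reverse B , reverse A , eq A B)
                  ; (bwd (A , B , refl)) → fwd (reverse B , reverse A , eq A B) }
    where
    eq : ∀ A B {s t : Vertex n} → reverse (A ++ s ∷ t ∷ B) ≡ reverse B ++ t ∷ s ∷ reverse A
    eq A B {s} {t} = trans (List.reverse-++ A (s ∷ t ∷ B))
      (trans (cong (_++ reverse A) (List.reverse-++ (s ∷ t ∷ []) B))
        (List.++-assoc (reverse B) (t ∷ s ∷ []) (reverse A)))

  adj-first : ∀ {a b p xs} → Span a xs b → ∀ ys → Adj (p ∷ xs ++ ys) p a
  adj-first (_ , refl) ys = fwd ([] , _ , refl)

  adj-last : ∀ {a b q xs} → Span a xs b → ∀ ys → Adj (xs ++ q ∷ ys) b q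
  adj-last {a} {b} {q} (ms , refl) ys = fwd (a ∷ ms , ys , cong (a ∷_) (List.++-assoc ms [ b ] (q ∷ ys)))

  linked⇒adj⊆ : ∀ {R : Rel (Vertex n) 0ℓ} {xs} → Symmetric R → Linked R xs → ∀ {s t} → Adj xs s t → R s t
  linked⇒adj⊆ R-sym rs (fwd (A , _ , refl)) = Linked.head (linked-++⁻ʳ A rs)
  linked⇒adj⊆ R-sym rs (bwd (A , _ , refl)) = R-sym (Linked.head (linked-++⁻ʳ A rs))

  follows : ∀ {D : Rel (Vertex n) 0ℓ} (P : HamPath) → (∀ {s t} → D s t → Edge s t) →
            Linked (SymClosure D) (closeUp (verts P)) →
            (∀ {s t} → D s t → Adj (closeUp (verts P)) s t) → P Follows (SymClosure D)
  follows P D⊆ lk cover = record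
    { closed = Linked.map (Sym.map D⊆) lk
    ; edges  = λ s t → mk⇔ (Sym.fold Adj-sym cover) (linked⇒adj⊆ (Sym.symmetric _) lk)
    }

  U-rank : ∀ i → U (toℕ i) ≡ u i
  U-rank i = cong u (clamp-toℕ i refl)

  V-rank : ∀ i → V (toℕ i) ≡ v (suc i)
  V-rank i = cong v (clamp-toℕ (suc i) refl)

  -- Ports `βγ` suffice: this is the part of the initial path `P₀`, and every later path inherits
  -- being Hamiltonian through the flips.
  H-above : ∀ m j → j + m ≡ n → All (λ s → suc j ≤ rank s) (H βγ j m)
  H-above zero j eq rewrite bottom eq =
    ≤-reflexive (sym (rank-U (n≤1+n _))) ∷ ≤-reflexive (sym (rank-V ≤-refl)) ∷
    ≤-trans (n≤1+n _) (≤-reflexive (sym (rank-U ≤-refl))) ∷ []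
  H-above (suc m) j eq =
    ≤-reflexive (sym (rank-U (m≤n⇒m≤1+n (m≤n⇒m≤1+n (level<n eq))))) ∷
    ≤-reflexive (sym (rank-V (m≤n⇒m≤1+n (level<n eq)))) ∷
    subst (All _) (reverse-H βγ (suc j) m)
      (↭.All-resp-↭ (↭-sym (↭.↭-reverse _)) (All.map <⇒≤ (H-above m (suc j) (next eq))))

  H-unique : ∀ m j → j + m ≡ n → Unique (H βγ j m)
  H-unique zero j eq rewrite bottom eq =
    ((λ ()) ∷ U≢U ∷ []) ∷ ((λ ()) ∷ []) ∷ [] ∷ []
    where
    U≢U : U (1 + n) ≢ U (2 + n)
    U≢U e = 1+n≢n (sym (trans (sym (rank-U (n≤1+n _))) (trans (cong rank e) (rank-U ≤-refl))))
  H-unique (suc m) j eq =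
    ((λ ()) ∷ fresh (rank-U (m≤n⇒m≤1+n (m≤n⇒m≤1+n (level<n eq))))) ∷
    fresh (rank-V (m≤n⇒m≤1+n (level<n eq))) ∷
    unique-↭ rev (H-unique m (suc j) (next eq))
    where
    rev : H βγ (suc j) m ↭ H γβ (suc j) m
    rev = ↭-trans (↭-sym (↭.↭-reverse _)) (↭-reflexive (reverse-H βγ (suc j) m))
    fresh : ∀ {s} → rank s ≡ suc j → All (s ≢_) (H γβ (suc j) m)
    fresh r = All.map (λ { l refl → <⇒≢ l (sym r) }) (↭.All-resp-↭ rev (H-above m (suc j) (next eq)))

  H-spanning : ∀ m j → j + m ≡ n → ∀ s → suc j ≤ rank s → s ∈ H βγ j m
  H-spanning zero j eq (u i) l rewrite bottom eq with m≤n⇒m<n∨m≡n l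
  ... | inj₁ l′ = there (there (here (trans (sym (U-rank i)) (cong U (≤-antisym (toℕ≤pred[n] i) l′)))))
  ... | inj₂ e  = here (trans (sym (U-rank i)) (cong U (sym e)))
  H-spanning zero j eq (v (suc i)) l rewrite bottom eq =
    there (here (trans (sym (V-rank i)) (cong V (≤-antisym (toℕ≤pred[n] i) l))))
  H-spanning (suc m) j eq s l with m≤n⇒m<n∨m≡n l
  ... | inj₁ l′ = there (there (subst (s ∈_) (reverse-H βγ (suc j) m)
    (↭.∈-resp-↭ (↭-sym (↭.↭-reverse _)) (H-spanning m (suc j) (next eq) s l′))))
  H-spanning (suc m) j eq (u i) l | inj₂ e = here (trans (sym (U-rank i)) (cong U (sym e)))
  H-spanning (suc m) j eq (v (suc i)) l | inj₂ e = there (here (trans (sym (V-rank i)) (cong V (sym e))))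

  C₀-sym : Symmetric (C₀ n)
  C₀-sym = Sym.symmetric _

  C₁-sym : Symmetric (C₁ n)
  C₁-sym = Sym.symmetric _

  linked₀ : ∀ m j → j + m ≡ n → Linked (C₀ n) (H βγ j m)
  linked₀ zero j eq rewrite bottom eq =
    subst₂ (C₀ n) c′≡ a≡ (bwd ac′) ∷ subst₂ (C₀ n) a≡ b≡ (fwd ab) ∷ [-]
  linked₀ (suc m) j eq =
    at-inside (C₀ n) (λ i _ → fwd (inside i)) (level<n eq) ∷
    linked-∷ (span-H γβ (suc j) m) (at-vu (C₀ n) (λ i _ → fwd (vu i)) (level<n eq))
      (subst (Linked (C₀ n)) (reverse-H βγ (suc j) m)
        (linked-reverse C₀-sym (linked₀ m (suc j) (next eq))))

  parity-suc : ∀ j {p} → parity j ≡ p → parity (suc j) ≡ p ⁻¹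
  parity-suc j eq = trans (sym (suc-homo-⁻¹ (suc j))) (cong _⁻¹ eq)

  parity-pred : ∀ j {p} → parity (suc j) ≡ p → parity j ≡ p ⁻¹
  parity-pred j eq = trans (sym (suc-homo-⁻¹ j)) (cong _⁻¹ eq)

  -- C₁ traverses the part of rank > j, where k = j + 1, from β to α for even j
  -- and from α to γ (up to orientation) for odd j.
  ports₁ : Parity → Ports
  ports₁ 0ℙ = βα
  ports₁ 1ℙ = αγ

  linked₁ : ∀ m j {p} → j + m ≡ n → parity j ≡ p → Linked (C₁ n) (H (ports₁ p) j m)
  linked₁ zero j {0ℙ} eq par rewrite bottom eq =
    subst₂ (C₁ n) c′≡ b≡ (bwd bc′) ∷ subst₂ (C₁ n) b≡ a≡ (bwd (ab par)) ∷ [-]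
  linked₁ zero j {1ℙ} eq par rewrite bottom eq =
    subst₂ (C₁ n) a≡ c′≡ (fwd (ac′ par)) ∷ subst₂ (C₁ n) c′≡ b≡ (bwd bc′) ∷ [-]
  linked₁ (suc m) j {0ℙ} eq par =
    linked-∷ (span-∷ʳ _ (span-H αγ (suc j) m)) (at-uv (C₁ n) (λ i → fwd (uv i)) (level<n eq))
      (linked-∷ʳ (span-H αγ (suc j) m) (linked₁ m (suc j) (next eq) (parity-suc j par))
        (C₁-sym (at-vu (C₁ n) (λ i e → fwd (vu i (trans (cong parity e) par))) (level<n eq))))
  linked₁ (suc m) j {1ℙ} eq par =
    C₁-sym (at-inside (C₁ n)
      (λ i e → fwd (inside i (trans (cong (λ k → parity (suc k)) e) (parity-suc j par)))) (level<n eq)) ∷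
    linked-∷ (span-H αβ (suc j) m) (at-uv (C₁ n) (λ i → fwd (uv i)) (level<n eq))
      (subst (Linked (C₁ n)) (reverse-H βα (suc j) m)
        (linked-reverse C₁-sym (linked₁ m (suc j) (next eq) (parity-suc j par))))

  adj-opposite : ∀ d j m {s t} → Adj (H d j m) s t → Adj (H (opposite d) j m) s t
  adj-opposite d j m r = subst (λ X → Adj X _ _) (reverse-H d j m) (adj-reverse r)

  module _ {T : Rel (Vertex n) 0ℓ} (H⊆T : ∀ {s t} → Adj (H βγ 0 n) s t → T s t) where

    -- The path through a smaller part is, up to reversal, a block of the path through the next
    -- larger one, so adjacencies are carried outwards level by level.
    descend₀ : ∀ j m → j + m ≡ n → ∀ {s t} → Adj (H βγ j m) s t → T s t
    descend₀ zero    m refl r = H⊆T r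
    descend₀ (suc j) m eq   r = descend₀ j (suc m) (trans (+-suc j m) eq)
      (adj-++ˡ (U (suc j) ∷ V (suc j) ∷ []) (adj-opposite βγ (suc j) m r))

    inside₀ : ∀ {j} → j < n → T (U (suc j)) (V (suc j))
    inside₀ {j} j<n with m , eq ← remaining j<n = descend₀ j (suc m) eq (fwd ([] , _ , refl))

    vu₀ : ∀ {j} → j < n → T (V (suc j)) (U (3 + j))
    vu₀ {j} j<n with m , eq ← remaining j<n =
      descend₀ j (suc m) eq
        (fwd ([ _ ] , _ , cong (λ X → _ ∷ _ ∷ X) (proj₂ (span-H γβ (suc j) m))))

    pac₀ : T c′ a × T a b
    pac₀ = subst₂ T (sym c′≡) (sym a≡) (descend₀ n 0 (+-identityʳ n) (fwd ([] , _ , refl)))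
         , subst₂ T (sym a≡) (sym b≡) (descend₀ n 0 (+-identityʳ n) (fwd ([ _ ] , _ , refl)))

  module _ {T : Rel (Vertex n) 0ℓ} (H⊆T : ∀ {s t} → Adj (H βα 0 n) s t → T s t) where

    -- The ports alternate with the level: the `βα` path contains the `αγ` path of the next level as
    -- it stands, and the `αγ` path contains the next `βα` path reversed.
    descend₁ : ∀ j m {p} → j + m ≡ n → parity j ≡ p → ∀ {s t} → Adj (H (ports₁ p) j m) s t → T s t
    descend₁ zero    m refl refl r = H⊆T r
    descend₁ (suc j) m {1ℙ} eq par r =
      descend₁ j (suc m) (trans (+-suc j m) eq) (parity-pred j par) (adj-++ [ U (suc j) ] [ V (suc j) ] r)
    descend₁ (suc j) m {0ℙ} eq par r =
      descend₁ j (suc m) (trans (+-suc j m) eq) (parity-pred j par)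
        (adj-++ˡ (V (suc j) ∷ U (suc j) ∷ []) (adj-opposite βα (suc j) m r))

    inside₁ : ∀ {j} → j < n → parity j ≡ 1ℙ → T (V (suc j)) (U (suc j))
    inside₁ {j} j<n par with m , eq ← remaining j<n = descend₁ j (suc m) eq par (fwd ([] , _ , refl))

    uv₁ : ∀ {j} → j < n → T (U (suc j)) (V (2 + j))
    uv₁ {j} j<n with m , eq ← remaining j<n with parity j in par
    ... | 0ℙ = descend₁ j (suc m) eq par (adj-first (span-H αγ (suc j) m) _)
    ... | 1ℙ = descend₁ j (suc m) eq par
      (fwd ([ _ ] , _ , cong (λ X → _ ∷ _ ∷ X) (proj₂ (span-H αβ (suc j) m))))

    vu₁ : ∀ {j} → j < n → parity j ≡ 0ℙ → T (U (3 + j)) (V (suc j))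
    vu₁ {j} j<n par with m , eq ← remaining j<n =
      descend₁ j (suc m) eq par (adj-++ˡ [ U (suc j) ] (adj-last (span-H αγ (suc j) m) []))

    ab₁ : parity n ≡ 0ℙ → T b a
    ab₁ par = subst₂ T (sym b≡) (sym a≡) (descend₁ n 0 (+-identityʳ n) par (fwd ([ _ ] , _ , refl)))

    ac′₁ : parity n ≡ 1ℙ → T a c′
    ac′₁ par = subst₂ T (sym a≡) (sym c′≡) (descend₁ n 0 (+-identityʳ n) par (fwd ([] , _ , refl)))

    c′b₁ : T c′ b
    c′b₁ with parity n in par
    ... | 0ℙ = subst₂ T (sym c′≡) (sym b≡) (descend₁ n 0 (+-identityʳ n) par (fwd ([] , _ , refl)))
    ... | 1ℙ = subst₂ T (sym c′≡) (sym b≡) (descend₁ n 0 (+-identityʳ n) par (fwd ([ _ ] , _ , refl)))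

  path₀ path₁ : List (Vertex n)
  path₀ = H βγ 0 n ++ y ∷ x ∷ []
  path₁ = H βα 0 n ++ x ∷ y ∷ []

  Edge₀⊆Edge : ∀ {s t : Vertex n} → Edge₀ s t → Edge s t
  Edge₀⊆Edge (inside i) = inside i
  Edge₀⊆Edge (vu i)     = vu i
  Edge₀⊆Edge Λx         = Λx
  Edge₀⊆Edge xy         = xy
  Edge₀⊆Edge ab         = ab
  Edge₀⊆Edge ac′        = ac′

  Edge₁⊆Edge : ∀ {s t : Vertex n} → Edge₁ s t → Edge s t
  Edge₁⊆Edge (inside i _) = inside i
  Edge₁⊆Edge (uv i)       = uv i
  Edge₁⊆Edge (vu i _)     = vu i
  Edge₁⊆Edge Λy           = Λy
  Edge₁⊆Edge xy           = xy
  Edge₁⊆Edge (ab _)       = ab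
  Edge₁⊆Edge (ac′ _)      = ac′
  Edge₁⊆Edge bc′          = bc′

  private
    close : ∀ (xs : List (Vertex n)) {p q} → Λ ∷ xs ++ p ∷ q ∷ Λ ∷ [] ≡ closeUp (Λ ∷ xs ++ p ∷ q ∷ [])
    close xs = cong (Λ ∷_) (sym (List.++-assoc xs _ _))

  closed₀ : Linked (C₀ n) (closeUp (Λ ∷ path₀))
  closed₀ = subst (Linked (C₀ n)) (close (H βγ 0 n))
    (linked-∷ (span-++ (span-H βγ 0 n) ([ x ] , refl)) (fwd (vu zero))
      (linked-span-++ (span-H βγ 0 n) (linked₀ n 0 refl) (bwd (vu (suc zero)))
        (bwd xy ∷ bwd Λx ∷ [-])))

  closed₁ : Linked (C₁ n) (closeUp (Λ ∷ path₁))
  closed₁ = subst (Linked (C₁ n)) (close (H βα 0 n))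
    (linked-∷ (span-++ (span-H βα 0 n) ([ y ] , refl)) (fwd (vu zero refl))
      (linked-span-++ (span-H βα 0 n) (linked₁ n 0 refl refl) (bwd (uv zero))
        (fwd xy ∷ bwd Λy ∷ [-])))

  cover₀ : ∀ {s t} → Edge₀ s t → Adj (closeUp (Λ ∷ path₀)) s t
  cover₀ = go
    where
    T : Rel (Vertex n) 0ℓ
    T = Adj (closeUp (Λ ∷ path₀))
    whole : ∀ {s t} → Adj (Λ ∷ H βγ 0 n ++ y ∷ x ∷ Λ ∷ []) s t → T s t
    whole {s} {t} = subst (λ X → Adj X s t) (close (H βγ 0 n))
    H⊆T : ∀ {s t} → Adj (H βγ 0 n) s t → T s t
    H⊆T r = whole (adj-++ [ Λ ] _ r)
    go : ∀ {s t} → Edge₀ s t → T s t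
    go (inside i) = subst₂ T (sym (inside-u≡ i)) (sym (inside-v≡ i)) (inside₀ {T} H⊆T (toℕ<n i))
    go (vu zero) = whole (adj-first (span-H βγ 0 n) _)
    go (vu (suc zero)) = whole (Adj-sym (adj-++ˡ [ Λ ] (adj-last (span-H βγ 0 n) _)))
    go (vu (suc (suc i))) = subst₂ T (sym (vu-v≡ (suc i))) (sym (vu-u≡ (suc (suc i)))) (vu₀ {T} H⊆T (toℕ<n i))
    go Λx = whole (bwd (Λ ∷ H βγ 0 n ++ [ y ] , [] , cong (Λ ∷_) (sym (List.++-assoc (H βγ 0 n) _ _))))
    go xy = whole (bwd (Λ ∷ H βγ 0 n , _ , refl))
    go ab = proj₂ (pac₀ {T} H⊆T)
    go ac′ = Adj-sym (proj₁ (pac₀ {T} H⊆T))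

  cover₁ : ∀ {s t} → Edge₁ s t → Adj (closeUp (Λ ∷ path₁)) s t
  cover₁ = go
    where
    T : Rel (Vertex n) 0ℓ
    T = Adj (closeUp (Λ ∷ path₁))
    whole : ∀ {s t} → Adj (Λ ∷ H βα 0 n ++ x ∷ y ∷ Λ ∷ []) s t → T s t
    whole {s} {t} = subst (λ X → Adj X s t) (close (H βα 0 n))
    H⊆T : ∀ {s t} → Adj (H βα 0 n) s t → T s t
    H⊆T r = whole (adj-++ [ Λ ] _ r)
    go : ∀ {s t} → Edge₁ s t → T s t
    go (inside i par) = subst₂ T (sym (inside-u≡ i)) (sym (inside-v≡ i))
      (Adj-sym (inside₁ {T} H⊆T (toℕ<n i) (parity-pred (toℕ i) par)))
    go (uv zero) = whole (Adj-sym (adj-++ˡ [ Λ ] (adj-last (span-H βα 0 n) _)))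
    go (uv (suc i)) = subst₂ T (sym (uv-u≡ (suc i))) (sym (uv-v≡ (suc i))) (uv₁ {T} H⊆T (toℕ<n i))
    go (vu zero _) = whole (adj-first (span-H βα 0 n) _)
    -- The index `suc zero`, that is, the edge from y to u₂, is excluded by its parity.
    go (vu (suc (suc i)) par) = subst₂ T (sym (vu-v≡ (suc i))) (sym (vu-u≡ (suc (suc i))))
      (Adj-sym (vu₁ {T} H⊆T (toℕ<n i) par))
    go Λy = whole (bwd (Λ ∷ H βα 0 n ++ [ x ] , [] , cong (Λ ∷_) (sym (List.++-assoc (H βα 0 n) _ _))))
    go xy = whole (fwd (Λ ∷ H βα 0 n , _ , refl))
    go (ab par) = Adj-sym (ab₁ {T} H⊆T par)
    go (ac′ par) = ac′₁ {T} H⊆T par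
    go bc′ = Adj-sym (c′b₁ {T} H⊆T)

  P₀ : HamPath
  P₀ = record
    { verts    = Λ ∷ path₀
    ; linked   = Linked.map (Sym.map Edge₀⊆Edge) (linked-prefix (Λ ∷ path₀) closed₀)
    ; unique   = All-++⁺ (All.map (λ { l refl → <⇒≢ l refl }) above) ((λ ()) ∷ (λ ()) ∷ []) ∷
        unique-++⁺ (H-unique n 0 refl) (((λ ()) ∷ []) ∷ [] ∷ []) disjoint
    ; spanning = spanning₀
    }
    where
    above : All (λ s → 1 ≤ rank s) (H βγ 0 n)
    above = H-above n 0 refl
    disjoint : ∀ {s} → ¬ (s ∈ H βγ 0 n × s ∈ y ∷ x ∷ [])
    disjoint (s∈ , here refl)         with () ← All.lookup above s∈
    disjoint (s∈ , there (here refl)) with () ← All.lookup above s∈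
    spanning₀ : ∀ s → s ∈ Λ ∷ path₀
    spanning₀ (u zero)          = there (∈-++⁺ʳ (H βγ 0 n) (there (here refl)))
    spanning₀ (v zero)          = here refl
    spanning₀ (v (suc zero))    = there (∈-++⁺ʳ (H βγ 0 n) (here refl))
    spanning₀ s@(u (suc _))       = there (∈-++⁺ˡ (H-spanning n 0 refl s (s≤s z≤n)))
    spanning₀ s@(v (suc (suc _))) = there (∈-++⁺ˡ (H-spanning n 0 refl s (s≤s z≤n)))

  -- In `path₀` the last vertex is x and its predecessor is y, which leaves the port α as pivot;
  -- `neighbours-y` does the same for `path₁` and the port γ.
  neighbours-x : ∀ s → s ~ x → s ≡ Λ ⊎ s ≡ y ⊎ s ≡ V 1
  neighbours-x s (fwd e) = go e refl
    where
    go : ∀ {s t} → Edge s t → t ≡ x → s ≡ Λ ⊎ s ≡ y ⊎ s ≡ V 1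
    go Λx _ = inj₁ refl
    go ac′ ()
    go (vu i) ()
  neighbours-x s (bwd e) = go e refl
    where
    go : ∀ {s t} → Edge t s → t ≡ x → s ≡ Λ ⊎ s ≡ y ⊎ s ≡ V 1
    go xy _ = inj₂ (inj₁ refl)
    go (inside i) ()
    go (uv zero) _ = inj₂ (inj₂ refl)

  neighbours-y : ∀ s → s ~ y → s ≡ Λ ⊎ s ≡ x ⊎ s ≡ U 2
  neighbours-y s (fwd e) = go e refl
    where
    go : ∀ {s t} → Edge s t → t ≡ y → s ≡ Λ ⊎ s ≡ x ⊎ s ≡ U 2
    go Λy _ = inj₁ refl
    go xy _ = inj₂ (inj₁ refl)
  neighbours-y s (bwd e) = go e refl
    where
    go : ∀ {s t} → Edge t s → t ≡ y → s ≡ Λ ⊎ s ≡ x ⊎ s ≡ U 2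
    go (vu (suc zero)) _ = inj₂ (inj₂ refl)

  thomason : Thomason (C₀ n) Λ u₁ (C₁ n) (lengthβ n)
  thomason with run P₀ refl (atMostOne P₀ refl (Λ ∷ H βγ 0 n , refl) neighbours-x)
                  (Tour.walk tour) stuck path₀≢path₁
    where
    tour : Excursion 0 (lengthβ n) path₀ path₁
    -- The whole graph outside the cap is the part for `j = 0`; after Λ is set aside, the remaining
    -- cap vertices y, x form the segment `L`.
    tour = tourβ n 0 refl ([] , refl) (bwd (vu (suc zero))) (bwd (uv zero))
    stuck : ∀ S → verts S ≡ Λ ∷ path₁ → AtMostOne S
    stuck S eq = atMostOne S eq (Λ ∷ H βα 0 n , eq) neighbours-y
    path₀≢path₁ : path₀ ≢ path₁
    path₀≢path₁ eq with () ← last-injective (H βγ 0 n ++ [ y ]) (H βα 0 n ++ [ x ])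
      (trans (List.++-assoc (H βγ 0 n) _ _) (trans eq (sym (List.++-assoc (H βα 0 n) _ _))))
  ... | S , eqS , r =
    P₀ , S , (_ , cong (λ X → Λ ∷ X ++ y ∷ x ∷ []) (proj₂ (span-H βγ 0 n))) ,
    follows P₀ Edge₀⊆Edge closed₀ cover₀ , r ,
    follows S Edge₁⊆Edge (subst (λ X → Linked (C₁ n) (closeUp X)) (sym eqS) closed₁)
      (λ {s} {t} e → subst (λ X → Adj (closeUp X) s t) (sym eqS) (cover₁ e))

-- The recurrence for the number of lollipops, and rational arithmetic

lengthβ-recurrence : ∀ m → lengthβ (4 + m) ≡ 8 + (lengthβ (1 + m) + lengthβ (1 + m) + lengthβ m)
lengthβ-recurrence m = rearrange (lengthβ (1 + m)) (lengthβ m)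
  where
  rearrange : ∀ s t → 1 + ((s + 1) + (1 + ((1 + (s + 1)) + (1 + ((t + 1) + 1)))))
              ≡ 8 + (s + s + t)
  rearrange = solve-∀

ι : ℕ → ℚ
ι n = + n / 1

ι-+ : ∀ m n → ι (m + n) ≡ ι m ℚ.+ ι n
ι-+ m n = ℚ.toℚᵘ-injective (begin
  ℚ.toℚᵘ (ι (m + n))
    ≈⟨ ℚ.toℚᵘ-fromℚᵘ (mkℚᵘ (+ (m + n)) 0) ⟩
  mkℚᵘ (+ (m + n)) 0
    ≈⟨ *≡* (cong (ℤ._* + 1) (sym (cong₂ ℤ._+_ (ℤ.*-identityʳ (+ m)) (ℤ.*-identityʳ (+ n))))) ⟩
  mkℚᵘ (+ m) 0 ℚᵘ.+ mkℚᵘ (+ n) 0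
    ≈⟨ ℚᵘ.+-cong (ℚ.toℚᵘ-fromℚᵘ (mkℚᵘ (+ m) 0)) (ℚ.toℚᵘ-fromℚᵘ (mkℚᵘ (+ n) 0)) ⟨
  ℚ.toℚᵘ (ι m) ℚᵘ.+ ℚ.toℚᵘ (ι n)
    ≈⟨ ℚ.toℚᵘ-homo-+ (ι m) (ι n) ⟨
  ℚ.toℚᵘ (ι m ℚ.+ ι n) ∎)
  where open ℚᵘ.≃-Reasoning

archimedean : ∀ ε → 0ℚ ℚ.< ε → ∃[ N ] 1ℚ ℚ.≤ ε ℚ.* ι N
-- A positive fraction times its denominator is its numerator, which is at least 1.
archimedean ε@(mkℚ +[1+ p ] d _) _ = suc d , ℚ.toℚᵘ-cancel-≤ (begin
  ℚ.toℚᵘ 1ℚ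
    ≤⟨ *≤* 1≤ ⟩
  mkℚᵘ +[1+ p ] d ℚᵘ.* mkℚᵘ (+ suc d) 0
    ≃⟨ ℚᵘ.*-congˡ {ℚ.toℚᵘ ε} (ℚ.toℚᵘ-fromℚᵘ (mkℚᵘ (+ suc d) 0)) ⟨
  ℚ.toℚᵘ ε ℚᵘ.* ℚ.toℚᵘ (ι (suc d))
    ≃⟨ ℚ.toℚᵘ-homo-* ε (ι (suc d)) ⟨
  ℚ.toℚᵘ (ε ℚ.* ι (suc d)) ∎)
  where
  open ℚᵘ.≤-Reasoning
  1≤ : + 1 ℤ.* + (suc d ℕ.* 1) ℤ.≤ (+[1+ p ] ℤ.* + suc d) ℤ.* + 1
  1≤ = subst₂ ℤ._≤_ (cong (λ k → + k) (sym (trans (ℕ.*-identityˡ (suc d ℕ.* 1)) (ℕ.*-identityʳ (suc d)))))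
                     (sym (ℤ.*-identityʳ (+[1+ p ] ℤ.* + suc d)))
          (ℤ.+≤+ (ℕ.m≤m+n (suc d) (p ℕ.* suc d)))
archimedean (mkℚ (+ 0) _ _) (ℚ.*<* (ℤ.+<+ ()))
archimedean (mkℚ ℤ.-[1+ _ ] _ _) (ℚ.*<* ())

0≤-+ : ∀ {p q} → 0ℚ ℚ.≤ p → 0ℚ ℚ.≤ q → 0ℚ ℚ.≤ p ℚ.+ q
0≤-+ = ℚ.+-mono-≤

*-mono-≤ : ∀ {p q r s} → 0ℚ ℚ.≤ q → 0ℚ ℚ.≤ r → p ℚ.≤ q → r ℚ.≤ s → p ℚ.* r ℚ.≤ q ℚ.* s
*-mono-≤ {q = q} {r} 0≤q 0≤r p≤q r≤s = ℚ.≤-trans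
  (ℚ.*-monoʳ-≤-nonNeg r {{ℚ.nonNegative 0≤r}} p≤q)
  (ℚ.*-monoˡ-≤-nonNeg q {{ℚ.nonNegative 0≤q}} r≤s)

0≤-* : ∀ {p q} → 0ℚ ℚ.≤ p → 0ℚ ℚ.≤ q → 0ℚ ℚ.≤ p ℚ.* q
0≤-* {p} {q} 0≤p 0≤q = subst (ℚ._≤ p ℚ.* q) (ℚ.*-zeroˡ q)
  (ℚ.*-monoʳ-≤-nonNeg q {{ℚ.nonNegative 0≤q}} 0≤p)

≤-+ˡ : ∀ {p q} → 0ℚ ℚ.≤ q → p ℚ.≤ p ℚ.+ q
≤-+ˡ {p} {q} 0≤q = subst (ℚ._≤ p ℚ.+ q) (ℚ.+-identityʳ p) (ℚ.+-monoʳ-≤ p 0≤q)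

pow : ℚ → ℕ → ℚ
pow q zero    = 1ℚ
pow q (suc m) = q ℚ.* pow q m

2ℚ : ℚ
2ℚ = ι 2

0≤1 : 0ℚ ℚ.≤ 1ℚ
0≤1 = toWitness {a? = 0ℚ ℚ.≤? 1ℚ} _

0≤2 : 0ℚ ℚ.≤ 2ℚ
0≤2 = toWitness {a? = 0ℚ ℚ.≤? 2ℚ} _

1≤pow : ∀ {q} → 1ℚ ℚ.≤ q → ∀ m → 1ℚ ℚ.≤ pow q m
1≤pow 1≤q zero    = ℚ.≤-refl
1≤pow 1≤q (suc m) = *-mono-≤ (ℚ.≤-trans 0≤1 1≤q) 0≤1 1≤q (1≤pow 1≤q m)

0≤pow : ∀ {q} → 1ℚ ℚ.≤ q → ∀ m → 0ℚ ℚ.≤ pow q m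
0≤pow 1≤q m = ℚ.≤-trans 0≤1 (1≤pow 1≤q m)

pow-mono : ∀ {q r} → 1ℚ ℚ.≤ q → q ℚ.≤ r → ∀ m → pow q m ℚ.≤ pow r m
pow-mono 1≤q q≤r zero    = ℚ.≤-refl
pow-mono 1≤q q≤r (suc m) =
  *-mono-≤ (ℚ.≤-trans 0≤1 (ℚ.≤-trans 1≤q q≤r)) (0≤pow 1≤q m) q≤r (pow-mono 1≤q q≤r m)

pow2-mono : ∀ {m n} → m ≤ n → pow 2ℚ m ℚ.≤ pow 2ℚ n
pow2-mono {n = n} z≤n = 1≤pow (toWitness {a? = 1ℚ ℚ.≤? 2ℚ} _) n
pow2-mono (s≤s l) = ℚ.*-monoˡ-≤-nonNeg 2ℚ (pow2-mono l)

ι≤pow2 : ∀ m → ι m ℚ.≤ pow 2ℚ m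
ι≤pow2 zero    = 0≤1
ι≤pow2 (suc m) = begin
  ι (suc m)             ≡⟨ ι-+ 1 m ⟩
  1ℚ ℚ.+ ι m              ≤⟨ ℚ.+-mono-≤ (pow2-mono {0} {m} z≤n) (ι≤pow2 m) ⟩
  pow 2ℚ m ℚ.+ pow 2ℚ m   ≡⟨ double (pow 2ℚ m) ⟩
  2ℚ ℚ.* pow 2ℚ m         ∎
  where
  open ℚ.≤-Reasoning
  open +-*-Solver
  double : ∀ p → p ℚ.+ p ≡ 2ℚ ℚ.* p
  double = solve 1 (λ p → p :+ p := con 2ℚ :* p) refl

-- The growth constant by bisection

quartic : ℚ → ℚ
quartic q = q ℚ.* (q ℚ.* (q ℚ.* q))

linear : ℚ → ℚ
linear q = 2ℚ ℚ.* q ℚ.+ 1ℚ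

pow-4+ : ∀ q m → pow q (4 + m) ≡ quartic q ℚ.* pow q m
pow-4+ q m = assoc q (pow q m)
  where
  open +-*-Solver
  assoc : ∀ q p → q ℚ.* (q ℚ.* (q ℚ.* (q ℚ.* p))) ≡ q ℚ.* (q ℚ.* (q ℚ.* q)) ℚ.* p
  assoc = solve 2 (λ q p → q :* (q :* (q :* (q :* p))) := q :* (q :* (q :* q)) :* p) refl

-- 1.3953 < c < 1.39535.
lowest highest : ℚ
lowest  = + 13953 / 10000
highest = + 27907 / 20000

width : ℕ → ℚ
width zero    = + 1 / 20000
width (suc k) = ½ ℚ.* width k

-- An interval of exact width `w` on which `quartic` minus `linear` changes sign. Since `above`
-- holds at the upper end without error, powers of that end satisfy the inequality wanted for the
-- upper bound.
record Bracket (bottom top w : ℚ) : Set where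
  field
    lo      : ℚ
    lo≥     : bottom ℚ.≤ lo
    hi≤     : lo ℚ.+ w ℚ.≤ top
    below   : quartic lo ℚ.≤ linear lo
    above   : linear (lo ℚ.+ w) ℚ.≤ quartic (lo ℚ.+ w)

  hi : ℚ
  hi = lo ℚ.+ w

open Bracket

halves : ∀ l w → l ℚ.+ ½ ℚ.* w ℚ.+ ½ ℚ.* w ≡ l ℚ.+ w
halves = solve 2 (λ l w → l :+ con ½ :* w :+ con ½ :* w := l :+ w) refl
  where open +-*-Solver

0≤½* : ∀ {w} → 0ℚ ℚ.≤ w → 0ℚ ℚ.≤ ½ ℚ.* w
0≤½* = 0≤-* {½} (toWitness {a? = 0ℚ ℚ.≤? ½} _)

0≤width : ∀ k → 0ℚ ℚ.≤ width k
0≤width zero    = toWitness {a? = 0ℚ ℚ.≤? width 0} _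
0≤width (suc k) = 0≤½* (0≤width k)

bisect : ∀ {bottom top w} → 0ℚ ℚ.≤ w → Bracket bottom top w → Bracket bottom top (½ ℚ.* w)
bisect {_} {top} {w} 0≤w B with linear (lo B ℚ.+ ½ ℚ.* w) ℚ.≤? quartic (lo B ℚ.+ ½ ℚ.* w)
... | yes p = record
  { lo = lo B ; lo≥ = lo≥ B ; below = below B ; above = p
  ; hi≤ = ℚ.≤-trans (ℚ.≤-trans (≤-+ˡ {q = ½ ℚ.* w} (0≤½* 0≤w)) (ℚ.≤-reflexive (halves (lo B) w)))
            (hi≤ B) }
... | no ¬p = record
  { lo = lo B ℚ.+ ½ ℚ.* w
  ; lo≥ = ℚ.≤-trans (lo≥ B) (≤-+ˡ (0≤½* 0≤w))
  ; below = ℚ.<⇒≤ (ℚ.≰⇒> ¬p)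
  ; hi≤ = subst (ℚ._≤ top) (sym (halves (lo B) w)) (hi≤ B)
  ; above = subst (λ h → linear h ℚ.≤ quartic h) (sym (halves (lo B) w)) (above B) }

bisect-lo : ∀ {bottom top w} (0≤w : 0ℚ ℚ.≤ w) (B : Bracket bottom top w) → lo B ℚ.≤ lo (bisect 0≤w B)
bisect-lo {w = w} 0≤w B with linear (lo B ℚ.+ ½ ℚ.* w) ℚ.≤? quartic (lo B ℚ.+ ½ ℚ.* w)
... | yes _ = ℚ.≤-refl
... | no _  = ≤-+ˡ (0≤½* 0≤w)

bisect-hi : ∀ {bottom top w} (0≤w : 0ℚ ℚ.≤ w) (B : Bracket bottom top w) → hi (bisect 0≤w B) ℚ.≤ hi B
bisect-hi {w = w} 0≤w B with linear (lo B ℚ.+ ½ ℚ.* w) ℚ.≤? quartic (lo B ℚ.+ ½ ℚ.* w)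
... | yes _ = ℚ.≤-trans (≤-+ˡ (0≤½* 0≤w)) (ℚ.≤-reflexive (halves (lo B) w))
... | no _  = ℚ.≤-reflexive (halves (lo B) w)

bracket : ∀ k → Bracket lowest highest (width k)
bracket zero = record
  { lo    = lowest
  ; lo≥   = ℚ.≤-refl
  ; hi≤   = toWitness {a? = (lowest ℚ.+ width 0) ℚ.≤? highest} _
  ; below = toWitness {a? = quartic lowest ℚ.≤? linear lowest} _
  ; above = toWitness {a? = linear (lowest ℚ.+ width 0) ℚ.≤? quartic (lowest ℚ.+ width 0)} _
  }
bracket (suc k) = bisect (0≤width k) (bracket k)

c-seq : ℕ → ℚ
c-seq k = hi (bracket k)

lo-mono : ∀ {N k} → N ℕ.≤′ k → lo (bracket N) ℚ.≤ lo (bracket k)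
lo-mono ℕ.≤′-refl = ℚ.≤-refl
lo-mono (ℕ.≤′-step {k} l) = ℚ.≤-trans (lo-mono l) (bisect-lo (0≤width k) (bracket k))

hi-anti : ∀ {N k} → N ℕ.≤′ k → c-seq k ℚ.≤ c-seq N
hi-anti ℕ.≤′-refl = ℚ.≤-refl
hi-anti (ℕ.≤′-step {k} l) = ℚ.≤-trans (bisect-hi (0≤width k) (bracket k)) (hi-anti l)

lo≤hi : ∀ k → lo (bracket k) ℚ.≤ c-seq k
lo≤hi k = ≤-+ˡ (0≤width k)

width-pow : ∀ k → width k ℚ.* pow 2ℚ k ≡ width 0
width-pow zero    = ℚ.*-identityʳ (width 0)
width-pow (suc k) = trans (cancel (width k) (pow 2ℚ k)) (width-pow k)
  where
  open +-*-Solver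
  cancel : ∀ w p → (½ ℚ.* w) ℚ.* (2ℚ ℚ.* p) ≡ w ℚ.* p
  cancel = solve 2 (λ w p → (con ½ :* w) :* (con 2ℚ :* p) := w :* p) refl

width₀≤1 : width 0 ℚ.≤ 1ℚ
width₀≤1 = toWitness {a? = width 0 ℚ.≤? 1ℚ} _

-- The product of `width N` and the N-th power of 2 is constant and at most 1, and that power is at
-- least N, so N at least 1/ε suffices.
width-small : ∀ ε → 0ℚ ℚ.< ε → ∃[ N ] width N ℚ.≤ ε
width-small ε 0<ε with N , 1≤εN ← archimedean ε 0<ε = N ,
  ℚ.*-cancelʳ-≤-pos (pow 2ℚ N)
    {{ℚ.positive (ℚ.<-≤-trans (ℚ.positive⁻¹ 1ℚ) (pow2-mono {0} {N} z≤n))}} (begin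
    width N ℚ.* pow 2ℚ N  ≡⟨ width-pow N ⟩
    width 0             ≤⟨ width₀≤1 ⟩
    1ℚ                  ≤⟨ 1≤εN ⟩
    ε ℚ.* ι N             ≤⟨ ℚ.*-monoˡ-≤-nonNeg ε {{ℚ.nonNegative (ℚ.<⇒≤ 0<ε)}} (ι≤pow2 N) ⟩
    ε ℚ.* pow 2ℚ N        ∎)
  where open ℚ.≤-Reasoning

diff≤ : ∀ {l p q w} → p ℚ.≤ l ℚ.+ w → l ℚ.≤ q → p ℚ.- q ℚ.≤ w
diff≤ {l} {p} {q} {w} p≤ l≤q = begin
  p ℚ.- q            ≤⟨ ℚ.+-mono-≤ p≤ (ℚ.neg-antimono-≤ l≤q) ⟩
  l ℚ.+ w ℚ.- l        ≡⟨ cancel l w ⟩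
  w                ∎
  where
  open ℚ.≤-Reasoning
  cancel : ∀ l w → l ℚ.+ w ℚ.- l ≡ w
  cancel = solve 2 (λ l w → l :+ w :- l := w) refl where open +-*-Solver

∣diff∣≤ : ∀ {l p q w} → p ℚ.≤ l ℚ.+ w → q ℚ.≤ l ℚ.+ w → l ℚ.≤ p → l ℚ.≤ q → ℚ.∣ p ℚ.- q ∣ ℚ.≤ w
∣diff∣≤ {l} {p} {q} {w} p≤ q≤ l≤p l≤q with ℚ.∣p∣≡p∨∣p∣≡-p (p ℚ.- q)
... | inj₁ eq = subst (ℚ._≤ w) (sym eq) (diff≤ p≤ l≤q)
... | inj₂ eq = subst (ℚ._≤ w) (sym (trans eq (swap p q))) (diff≤ q≤ l≤p)
  where
  swap : ∀ p q → ℚ.- (p ℚ.- q) ≡ q ℚ.- p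
  swap = solve 2 (λ p q → :- (p :- q) := q :- p) refl where open +-*-Solver

c-close : ∀ {N j k} → N ≤ j → N ≤ k → ℚ.∣ c-seq j ℚ.- c-seq k ∣ ℚ.≤ width N
c-close {N} {j} {k} N≤j N≤k = ∣diff∣≤ {lo (bracket N)} {c-seq j} {c-seq k} {width N}
  (hi-anti (ℕ.≤⇒≤′ N≤j)) (hi-anti (ℕ.≤⇒≤′ N≤k))
  (ℚ.≤-trans (lo-mono (ℕ.≤⇒≤′ N≤j)) (lo≤hi j)) (ℚ.≤-trans (lo-mono (ℕ.≤⇒≤′ N≤k)) (lo≤hi k))

c-cauchy : ∀ ε → 0ℚ ℚ.< ε → ∃[ N ] ∀ j k → N ≤ j → N ≤ k → ℚ.∣ c-seq j ℚ.- c-seq k ∣ ℚ.≤ ε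
c-cauchy ε 0<ε = proj₁ small , λ j k N≤j N≤k → ℚ.≤-trans (c-close N≤j N≤k) (proj₂ small)
  where
  small : ∃[ N ] width N ℚ.≤ ε
  small = width-small ε 0<ε

growth : ℝ
growth = mkℝ c-seq c-cauchy

lowest≤c : ∀ k → lowest ℚ.≤ c-seq k
lowest≤c k = ℚ.≤-trans (lo≥ (bracket k)) (lo≤hi k)

1≤lowest : 1ℚ ℚ.≤ lowest
1≤lowest = toWitness {a? = 1ℚ ℚ.≤? lowest} _

highest≤2 : highest ℚ.≤ 2ℚ
highest≤2 = toWitness {a? = highest ℚ.≤? 2ℚ} _

1≤c : ∀ k → 1ℚ ℚ.≤ c-seq k
1≤c k = ℚ.≤-trans 1≤lowest (lowest≤c k)

c≤2 : ∀ k → c-seq k ℚ.≤ 2ℚ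
c≤2 k = ℚ.≤-trans (hi≤ (bracket k)) highest≤2

0≤4 : 0ℚ ℚ.≤ ι 4
0≤4 = toWitness {a? = 0ℚ ℚ.≤? ι 4} _

0≤lowest : 0ℚ ℚ.≤ lowest
0≤lowest = toWitness {a? = 0ℚ ℚ.≤? lowest} _

0≤32 : 0ℚ ℚ.≤ ι 32
0≤32 = toWitness {a? = 0ℚ ℚ.≤? ι 32} _

-- The difference of the fourth powers is w (h + l)(h² + l²). With both ends at most 2, the factors
-- after w are at most 4 and 8, hence 32.
quartic-close : ∀ k → quartic (c-seq k) ℚ.≤ linear (c-seq k) ℚ.+ ι 32 ℚ.* width k
quartic-close k = begin
  quartic h
    ≡⟨ factor l w ⟩
  quartic l ℚ.+ w ℚ.* ((h ℚ.+ l) ℚ.* (h ℚ.* h ℚ.+ l ℚ.* l))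
    ≤⟨ ℚ.+-mono-≤ (below (bracket k)) (ℚ.*-monoˡ-≤-nonNeg w {{ℚ.nonNegative 0≤w}} small) ⟩
  linear l ℚ.+ w ℚ.* ι 32
    ≤⟨ ≤-+ˡ (0≤-* 0≤2 0≤w) ⟩
  linear l ℚ.+ w ℚ.* ι 32 ℚ.+ 2ℚ ℚ.* w
    ≡⟨ regroup l w ⟩
  linear h ℚ.+ ι 32 ℚ.* w ∎
  where
  open ℚ.≤-Reasoning
  l w h : ℚ
  l = lo (bracket k)
  w = width k
  h = l ℚ.+ w
  0≤w : 0ℚ ℚ.≤ w
  0≤w = 0≤width k
  l≤2 : l ℚ.≤ 2ℚ
  l≤2 = ℚ.≤-trans (lo≤hi k) (c≤2 k)
  0≤l : 0ℚ ℚ.≤ l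
  0≤l = ℚ.≤-trans 0≤lowest (lo≥ (bracket k))
  0≤h : 0ℚ ℚ.≤ h
  0≤h = ℚ.≤-trans 0≤l (lo≤hi k)
  square≤ : ∀ {p} → 0ℚ ℚ.≤ p → p ℚ.≤ 2ℚ → p ℚ.* p ℚ.≤ 2ℚ ℚ.* 2ℚ
  square≤ 0≤p p≤2 = *-mono-≤ 0≤2 0≤p p≤2 p≤2
  small : (h ℚ.+ l) ℚ.* (h ℚ.* h ℚ.+ l ℚ.* l) ℚ.≤ ι 32
  small = *-mono-≤ {q = ι 4} {s = ι 8} 0≤4
    (0≤-+ (0≤-* 0≤h 0≤h) (0≤-* 0≤l 0≤l))
    (ℚ.+-mono-≤ (c≤2 k) l≤2) (ℚ.+-mono-≤ (square≤ 0≤h (c≤2 k)) (square≤ 0≤l l≤2))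
  factor : ∀ l w → quartic (l ℚ.+ w) ≡
    quartic l ℚ.+ w ℚ.* ((l ℚ.+ w ℚ.+ l) ℚ.* ((l ℚ.+ w) ℚ.* (l ℚ.+ w) ℚ.+ l ℚ.* l))
  factor = solve 2 (λ l w → (l :+ w) :* ((l :+ w) :* ((l :+ w) :* (l :+ w))) :=
    l :* (l :* (l :* l)) :+ w :* ((l :+ w :+ l) :* ((l :+ w) :* (l :+ w) :+ l :* l))) refl
    where open +-*-Solver
  regroup : ∀ l w → linear l ℚ.+ w ℚ.* ι 32 ℚ.+ 2ℚ ℚ.* w ≡ linear (l ℚ.+ w) ℚ.+ ι 32 ℚ.* w
  regroup = solve 2 (λ l w → con 2ℚ :* l :+ con 1ℚ :+ w :* con (ι 32) :+ con 2ℚ :* w :=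
    con 2ℚ :* (l :+ w) :+ con 1ℚ :+ con (ι 32) :* w) refl
    where open +-*-Solver

-- The two bounds on the number of lollipops

ι-recurrence : ∀ m → ι (lengthβ (4 + m)) ≡
  ι 8 ℚ.+ (ι (lengthβ (1 + m)) ℚ.+ ι (lengthβ (1 + m)) ℚ.+ ι (lengthβ m))
ι-recurrence m = trans (cong ι (lengthβ-recurrence m)) (trans (ι-+ 8 (s + s + t))
  (cong (λ z → ι 8 ℚ.+ z) (trans (ι-+ (s + s) t) (cong (ℚ._+ ι t) (ι-+ s s)))))
  where
  s t : ℕ
  s = lengthβ (1 + m)
  t = lengthβ m

-- The constant term 8 of the recurrence pays for q⁴ exceeding 2q + 1 by δ.
pow≤lengthβ : ∀ {q δ N} → 1ℚ ℚ.≤ q → q ℚ.≤ 2ℚ → 0ℚ ℚ.≤ δ → quartic q ℚ.≤ linear q ℚ.+ δ →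
              δ ℚ.* pow 2ℚ N ℚ.≤ ι 8 →
              ∀ m → m ≤ N → pow q m ℚ.≤ ι (lengthβ m)
pow≤lengthβ {q} {δ} {N} 1≤q q≤2 0≤δ close tiny = go
  where
  open ℚ.≤-Reasoning
  pow≤ : ∀ m → pow 2ℚ m ℚ.≤ ι (lengthβ m) → pow q m ℚ.≤ ι (lengthβ m)
  pow≤ m = ℚ.≤-trans (pow-mono 1≤q q≤2 m)
  error≤8 : ∀ m → m ≤ N → δ ℚ.* pow q m ℚ.≤ ι 8
  error≤8 m m≤N = ℚ.≤-trans (ℚ.*-monoˡ-≤-nonNeg δ {{ℚ.nonNegative 0≤δ}}
    (ℚ.≤-trans (pow-mono 1≤q q≤2 m) (pow2-mono m≤N))) tiny
  expand : ∀ q δ p → (linear q ℚ.+ δ) ℚ.* p ≡ δ ℚ.* p ℚ.+ (q ℚ.* p ℚ.+ q ℚ.* p ℚ.+ p)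
  expand = solve 3 (λ q δ p → (con 2ℚ :* q :+ con 1ℚ :+ δ) :* p := δ :* p :+ (q :* p :+ q :* p :+ p)) refl
    where open +-*-Solver
  go : ∀ m → m ≤ N → pow q m ℚ.≤ ι (lengthβ m)
  -- The first values 3, 6, 10, 15 of `lengthβ` exceed the powers 1, 2, 4, 8 of 2.
  go 0 _ = pow≤ 0 (toWitness {a? = pow 2ℚ 0 ℚ.≤? ι 3} _)
  go 1 _ = pow≤ 1 (toWitness {a? = pow 2ℚ 1 ℚ.≤? ι 6} _)
  go 2 _ = pow≤ 2 (toWitness {a? = pow 2ℚ 2 ℚ.≤? ι 10} _)
  go 3 _ = pow≤ 3 (toWitness {a? = pow 2ℚ 3 ℚ.≤? ι 15} _)
  go (suc (suc (suc (suc m)))) l = begin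
    pow q (4 + m)
      ≡⟨ pow-4+ q m ⟩
    quartic q ℚ.* p
      ≤⟨ ℚ.*-monoʳ-≤-nonNeg p {{ℚ.nonNegative (0≤pow 1≤q m)}} close ⟩
    (linear q ℚ.+ δ) ℚ.* p
      ≡⟨ expand q δ p ⟩
    δ ℚ.* p ℚ.+ (q ℚ.* p ℚ.+ q ℚ.* p ℚ.+ p)
      ≤⟨ ℚ.+-mono-≤ (error≤8 m m≤N)
           (ℚ.+-mono-≤ (ℚ.+-mono-≤ (go (suc m) 1+m≤N) (go (suc m) 1+m≤N)) (go m m≤N)) ⟩
    ι 8 ℚ.+ (ι (lengthβ (1 + m)) ℚ.+ ι (lengthβ (1 + m)) ℚ.+ ι (lengthβ m))
      ≡⟨ ι-recurrence m ⟨
    ι (lengthβ (4 + m)) ∎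
    where
    p : ℚ
    p = pow q m
    m≤N : m ≤ N
    m≤N = ℕ.≤-trans (ℕ.m≤n+m m 4) l
    1+m≤N : 1 + m ≤ N
    1+m≤N = ℕ.≤-trans (ℕ.m≤n+m (1 + m) 3) l

-- The sequence lengthβ m + 4 satisfies the homogeneous recurrence.
lengthβ≤pow : ∀ {q} → 1ℚ ℚ.≤ q → linear q ℚ.≤ quartic q → ∀ m → ι (lengthβ m) ℚ.+ ι 4 ℚ.≤ ι 19 ℚ.* pow q m
lengthβ≤pow {q} 1≤q q≥ = go
  where
  open ℚ.≤-Reasoning
  -- The constant 19 is `lengthβ 3 + 4`, the largest of the four initial values 7, 10, 14, 19.
  ≤19 : ∀ m → ι (lengthβ m) ℚ.+ ι 4 ℚ.≤ ι 19 → ι (lengthβ m) ℚ.+ ι 4 ℚ.≤ ι 19 ℚ.* pow q m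
  ≤19 m l = ℚ.≤-trans l (ℚ.*-monoˡ-≤-nonNeg (ι 19) (1≤pow 1≤q m))
  regroup : ∀ s t → ι 8 ℚ.+ (s ℚ.+ s ℚ.+ t) ℚ.+ ι 4 ≡ (s ℚ.+ ι 4) ℚ.+ (s ℚ.+ ι 4) ℚ.+ (t ℚ.+ ι 4)
  regroup = solve 2 (λ s t → con (ι 8) :+ (s :+ s :+ t) :+ con (ι 4) :=
    (s :+ con (ι 4)) :+ (s :+ con (ι 4)) :+ (t :+ con (ι 4))) refl
    where open +-*-Solver
  collect : ∀ q p → ι 19 ℚ.* (q ℚ.* p) ℚ.+ ι 19 ℚ.* (q ℚ.* p) ℚ.+ ι 19 ℚ.* p ≡ ι 19 ℚ.* (linear q ℚ.* p)
  collect = solve 2 (λ q p → con (ι 19) :* (q :* p) :+ con (ι 19) :* (q :* p) :+ con (ι 19) :* p :=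
    con (ι 19) :* ((con 2ℚ :* q :+ con 1ℚ) :* p)) refl
    where open +-*-Solver
  go : ∀ m → ι (lengthβ m) ℚ.+ ι 4 ℚ.≤ ι 19 ℚ.* pow q m
  go 0 = ≤19 0 (toWitness {a? = (ι 3 ℚ.+ ι 4) ℚ.≤? ι 19} _)
  go 1 = ≤19 1 (toWitness {a? = (ι 6 ℚ.+ ι 4) ℚ.≤? ι 19} _)
  go 2 = ≤19 2 (toWitness {a? = (ι 10 ℚ.+ ι 4) ℚ.≤? ι 19} _)
  go 3 = ≤19 3 (toWitness {a? = (ι 15 ℚ.+ ι 4) ℚ.≤? ι 19} _)
  go (suc (suc (suc (suc m)))) = begin
    ι (lengthβ (4 + m)) ℚ.+ ι 4
      ≡⟨ cong (ℚ._+ ι 4) (ι-recurrence m) ⟩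
    ι 8 ℚ.+ (s ℚ.+ s ℚ.+ t) ℚ.+ ι 4
      ≡⟨ regroup s t ⟩
    (s ℚ.+ ι 4) ℚ.+ (s ℚ.+ ι 4) ℚ.+ (t ℚ.+ ι 4)
      ≤⟨ ℚ.+-mono-≤ (ℚ.+-mono-≤ (go (suc m)) (go (suc m))) (go m) ⟩
    ι 19 ℚ.* (q ℚ.* p) ℚ.+ ι 19 ℚ.* (q ℚ.* p) ℚ.+ ι 19 ℚ.* p
      ≡⟨ collect q p ⟩
    ι 19 ℚ.* (linear q ℚ.* p)
      ≤⟨ ℚ.*-monoˡ-≤-nonNeg (ι 19)
           (ℚ.*-monoʳ-≤-nonNeg p {{ℚ.nonNegative (0≤pow 1≤q m)}} q≥) ⟩
    ι 19 ℚ.* (quartic q ℚ.* p)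
      ≡⟨ cong (ι 19 ℚ.*_) (pow-4+ q m) ⟨
    ι 19 ℚ.* pow q (4 + m) ∎
    where
    p s t : ℚ
    p = pow q m
    s = ι (lengthβ (1 + m))
    t = ι (lengthβ m)

seq-^ : ∀ r n k → seq (r ^ℝ n) k ≡ pow (seq r k) n
seq-^ r zero    k = refl
seq-^ r (suc n) k = cong (seq r k ℚ.*_) (seq-^ r n k)

32width₀≤8 : ι 32 ℚ.* width 0 ℚ.≤ ι 8
32width₀≤8 = toWitness {a? = (ι 32 ℚ.* width 0) ℚ.≤? ι 8} _

lengthβ∈Θ : (λ n → fromℕ′ (lengthβ n)) ∈Θ (λ n → growth ^ℝ n)
lengthβ∈Θ = 1ℚ , ι 19 , ℚ.positive⁻¹ 1ℚ , ℚ.positive⁻¹ (ι 19) , 0 , λ n _ →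
  -- The comparison of reals may ignore the first `n` approximations. From then on the exponent `n`
  -- is at most `k`, and `tiny` keeps the accumulated error below 8.
  (λ ε ε>0 → n , λ k n≤k → begin
    1ℚ ℚ.* seq (growth ^ℝ n) k  ≡⟨ ℚ.*-identityˡ _ ⟩
    seq (growth ^ℝ n) k       ≡⟨ seq-^ growth n k ⟩
    pow (c-seq k) n           ≤⟨ pow≤lengthβ (1≤c k) (c≤2 k) (0≤-* {ι 32} 0≤32 (0≤width k))
                                   (quartic-close k) (tiny k) n n≤k ⟩
    ι (lengthβ n)             ≤⟨ ≤-+ˡ (ℚ.<⇒≤ ε>0) ⟩
    ι (lengthβ n) ℚ.+ ε         ∎) ,
  (λ ε ε>0 → 0 , λ k _ → begin
    ι (lengthβ n)                   ≤⟨ ≤-+ˡ {q = ι 4} 0≤4 ⟩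
    ι (lengthβ n) ℚ.+ ι 4             ≤⟨ lengthβ≤pow (1≤c k) (above (bracket k)) n ⟩
    ι 19 ℚ.* pow (c-seq k) n          ≡⟨ cong (ι 19 ℚ.*_) (seq-^ growth n k) ⟨
    ι 19 ℚ.* seq (growth ^ℝ n) k      ≤⟨ ≤-+ˡ (ℚ.<⇒≤ ε>0) ⟩
    ι 19 ℚ.* seq (growth ^ℝ n) k ℚ.+ ε  ∎)
  where
  open ℚ.≤-Reasoning
  tiny : ∀ k → ι 32 ℚ.* width k ℚ.* pow 2ℚ k ℚ.≤ ι 8
  tiny k = begin
    ι 32 ℚ.* width k ℚ.* pow 2ℚ k    ≡⟨ ℚ.*-assoc (ι 32) (width k) (pow 2ℚ k) ⟩
    ι 32 ℚ.* (width k ℚ.* pow 2ℚ k)  ≡⟨ cong (ι 32 ℚ.*_) (width-pow k) ⟩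
    ι 32 ℚ.* width 0               ≤⟨ 32width₀≤8 ⟩
    ι 8                          ∎

1<growth : fromℚ 1ℚ <ℝ growth
1<growth = width 0 , ℚ.positive⁻¹ (width 0) , 0 , λ k _ → ℚ.≤-trans gap (lowest≤c k)
  where
  gap : 1ℚ ℚ.+ width 0 ℚ.≤ lowest
  gap = toWitness {a? = (1ℚ ℚ.+ width 0) ℚ.≤? lowest} _

lowest≤growth : fromℚ lowest ≤ℝ growth
lowest≤growth ε ε>0 = 0 , λ k _ → ℚ.≤-trans (lowest≤c k) (≤-+ˡ (ℚ.<⇒≤ ε>0))

growth<13954 : growth <ℝ fromℚ (+ 13954 / 10000)
growth<13954 = width 0 , ℚ.positive⁻¹ (width 0) , 0 , λ k _ →
  ℚ.≤-trans (ℚ.+-monoˡ-≤ (width 0) (hi≤ (bracket k))) gap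
  where
  gap : highest ℚ.+ width 0 ℚ.≤ + 13954 / 10000
  gap = toWitness {a? = (highest ℚ.+ width 0) ℚ.≤? (+ 13954 / 10000)} _

theorem2 : Σ[ T ∈ (ℕ → ℕ) ]
    (∀ (n : ℕ) → 3 ≤ n →
    Lollipops.Thomason (G n) (C₀ n) Λ u₁ (C₁ n) (T n)) ×
    (Σ[ c ∈ ℝ ]
    fromℚ 1ℚ <ℝ c ×
    fromℚ (+ 13953 / 10000) ≤ℝ c ×
    c <ℝ fromℚ (+ 13954 / 10000) ×
    (λ n → fromℕ′ (T n)) ∈Θ (λ n → c ^ℝ n))
theorem2 = lengthβ , (λ n _ → Cycles.thomason n) ,
  growth , 1<growth , lowest≤growth , growth<13954 , lengthβ∈Θ
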